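{- There is an absolute constant $c>0$ such that for arbitrarily large $n$ there is an access sequence $\tilde X\in[n]^m$ (for some $m$) satisfying $\mathsf{Funnel}(\tilde X)\ge c\,\lg\lg n\cdot(\mathsf{Alt}_\mathcal{T}(\tilde X)+m)$ simultaneously for all reference trees $\mathcal{T}$ for $G_{\tilde X}$.
   Context: Geometric view: for $X=(x_1,\dots,x_m)$ let $G_X=\{(x_i,i): i\in[m]\}\subset\mathbb{R}^2$. For a point $p$ write $p.x,p.y$ for its coordinates, and for a set $P$ write $P.x=\{p.x:p\in P\}$, $P.y=\{p.y:p\in P\}$. Mixing value: for disjoint finite sets $L,R\subset\mathbb{R}$, $\mathrm{mix}(L,R)\in\{\mathtt{L},\mathtt{R}\}^*$ is the word obtained by listing $L\cup R$ in increasing order and writing $\mathtt{L}$ for elements of $L$ and $\mathtt{R}$ for elements of $R$; $\mathrm{blocks}(s)$ is $0$ for the empty word and otherwise the number of maximal runs of equal letters; $\mathrm{mixValue}(L,R)=\mathrm{blocks}(\mathrm{mix}(L,R))$. Alternation bound: let $P$ be a finite point set with distinct $y$-coordinates. A reference tree for $P$ is a binary tree in which every non-leaf node has exactly two children and whose leaves are labeled by the elements of $P.x$ in increasing left-to-right order. If $\mathcal{T}$ is a single node, $\mathsf{Alt}_\mathcal{T}(P)=0$. Otherwise, with left/right subtrees $\mathcal{T}_L,\mathcal{T}_R$ of the root, let $P_L=\{p\in P: p.x \text{ labels a leaf of } \mathcal{T}_L\}$, $P_R$ analogously, and $\mathsf{Alt}_\mathcal{T}(P)=\mathrm{mixValue}(P_L.y,P_R.y)+\mathsf{Alt}_{\mathcal{T}_L}(P_L)+\mathsf{Alt}_{\mathcal{T}_R}(P_R)$.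 Set $\mathsf{Alt}_\mathcal{T}(X)=\mathsf{Alt}_\mathcal{T}(G_X)$. Funnel bound: $\mathrm{rect}(p,q)$ is the smallest closed axis-aligned rectangle containing $p$ and $q$. For $p\in P$, the left funnel $F_L(P,p)$ is the set of $q\in P$ with $q.y<p.y$, $q.x<p.x$ and $P\cap\mathrm{rect}(p,q)=\{p,q\}$; the right funnel $F_R(P,p)$ is defined the same way with $q.x>p.x$. Let $f(P,p)=\mathrm{mixValue}(F_L(P,p).y,F_R(P,p).y)$ and $\mathsf{Funnel}(P)=\sum_{p\in P}f(P,p)$; $\mathsf{Funnel}(X)=\mathsf{Funnel}(G_X)$. $\lg$ denotes $\log_2$. -}

module Defs where

open import Data.Bool using (Bool; true; false; if_then_else_; not; _∧_; _∨_)
open import Data.Nat using (ℕ; zero; suc; _+_; _⊓_; _⊔_; _<ᵇ_; _≤ᵇ_; _≡ᵇ_; _<_)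
open import Data.Product using (_×_; _,_; proj₁; proj₂)
open import Data.List using (List; []; _∷_; map; filter; upTo; mapMaybe; foldr; _++_)
open import Data.Bool.ListAction using (any; all)
open import Data.Nat.ListAction using (sum)
open import Data.List.Membership.Propositional using (_∈_)
open import Data.List.Relation.Unary.Linked using (Linked)
open import Data.Maybe using (Maybe; just; nothing)
open import Function.Bundles using (_⇔_)
open import Relation.Unary using (Pred)
open import Relation.Nullary.Decidable using (T?)
open import Data.Bool using (T)

Point : Set
Point = ℕ × ℕ

Gfrom : ℕ → List ℕ → List Point
Gfrom k []       = []
Gfrom k (x ∷ xs) = (x , k) ∷ Gfrom (suc k) xs

G : List ℕ → List Point
G X = Gfrom 1 X

xs : List Point → List ℕ
xs = map proj₁

ys : List Point → List ℕ
ys = map proj₂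

_∈ᵇ_ : ℕ → List ℕ → Bool
v ∈ᵇ l = any (λ z → z ≡ᵇ v) l

maxList : List ℕ → ℕ
maxList = foldr _⊔_ 0

-- mix(L,R): list L ∪ R in increasing order, writing 𝙻 (true) for
-- elements of L and 𝚁 (false) for elements of R.
mix : List ℕ → List ℕ → List Bool
mix L R = mapMaybe label (upTo (suc (maxList (L ++ R))))
  where
  label : ℕ → Maybe Bool
  label y = if y ∈ᵇ L then just true else (if y ∈ᵇ R then just false else nothing)

changes : Bool → List Bool → ℕ
changes a []      = 0
changes a (b ∷ w) = (if (a ∧ b) ∨ (not a ∧ not b) then 0 else 1) + changes b w

blocks : List Bool → ℕ
blocks []      = 0
blocks (a ∷ w) = suc (changes a w)

mixValue : List ℕ → List ℕ → ℕ
mixValue L R = blocks (mix L R)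

data Tree : Set where
  leaf : ℕ → Tree
  node : Tree → Tree → Tree

leaves : Tree → List ℕ
leaves (leaf v)   = v ∷ []
leaves (node l r) = leaves l ++ leaves r

IsReferenceTree : Tree → List Point → Set
IsReferenceTree t P =
  Linked _<_ (leaves t) × (∀ v → (v ∈ leaves t) ⇔ (v ∈ xs P))

restrict : Tree → List Point → List Point
restrict t P = filter (λ p → T? (proj₁ p ∈ᵇ leaves t)) P

Alt : Tree → List Point → ℕ
Alt (leaf _)   P = 0
Alt (node l r) P =
  mixValue (ys (restrict l P)) (ys (restrict r P))
    + Alt l (restrict l P) + Alt r (restrict r P)

samePt : Point → Point → Bool
samePt (a , b) (c , d) = (a ≡ᵇ c) ∧ (b ≡ᵇ d)

inRect : Point → Point → Point → Bool
inRect (px , py) (qx , qy) (rx , ry) =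
  ((px ⊓ qx) ≤ᵇ rx) ∧ (rx ≤ᵇ (px ⊔ qx)) ∧ ((py ⊓ qy) ≤ᵇ ry) ∧ (ry ≤ᵇ (py ⊔ qy))

-- P ∩ rect(p,q) = {p,q}  (p , q ∈ P in all uses)
emptyRect : List Point → Point → Point → Bool
emptyRect P p q = all (λ r → not (inRect p q r) ∨ samePt r p ∨ samePt r q) P

leftFunnel : List Point → Point → List Point
leftFunnel P p = filter (λ q → T? ((proj₂ q <ᵇ proj₂ p) ∧ (proj₁ q <ᵇ proj₁ p) ∧ emptyRect P p q)) P

rightFunnel : List Point → Point → List Point
rightFunnel P p = filter (λ q → T? ((proj₂ q <ᵇ proj₂ p) ∧ (proj₁ p <ᵇ proj₁ q) ∧ emptyRect P p q)) P

funnelAt : List Point → Point → ℕ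
funnelAt P p = mixValue (ys (leftFunnel P p)) (ys (rightFunnel P p))

Funnel : List Point → ℕ
Funnel P = sum (map (funnelAt P) P)

{-# OPTIONS --safe #-}

-- Let d = 2 ^ k and n = 2 ^ d.  For every shift s < n, access the d keys s + 2 ^ i in
-- bit-reversal order of i, and repeat this round 2n times before passing to the next shift.
--
-- Funnel: bit reversal on 2h keys interleaves two copies of itself on the lower and the upper h
-- keys.  Each access keeps its funnel within its own half and also sees the access just before
-- it, which lies in the other half; in each pair of accesses one of the two thereby gains a
-- block.  So a round contributes at least d k / 2.
--
-- Alternation: at a node splitting an interval into parts of lengths l and r at c, a round
-- costs about min (A , B), where A and B count its keys in the two parts.  Over the whole tree
-- the units needed to reach min = 1 sum to less than d.  If A , B ≥ 2 then, keys being spaced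
-- exponentially, c - s ≤ 2 min (l , r); summed over all shifts the remaining cost at the node is
-- then at most Σ_i min (2 ^ i , 2 l , 2 r) over the i with 2 ^ i < 2 l + r, which is paid for by
-- the potential Σ_i (4 w ∸ 2 ^ i) of an interval of length w.  So any tree costs O(d) per round
-- on average over the shifts.
module Submission where

open import Defs
open import Data.Bool using (Bool; true; false; if_then_else_; not; _∧_; _∨_; T)
open import Data.Bool.ListAction using (all)
open import Data.Bool.Properties using (T-≡; T-∧; ∧-zeroʳ)
open import Data.Empty using (⊥-elim)
open import Data.List using (List; []; _∷_; _++_; map; length; filter; mapMaybe; upTo; applyUpTo; concat; replicate; applyDownFrom; initLast; _∷ʳ′_)
open import Data.List.Membership.Propositional using (_∈_)
open import Data.List.Properties using (++-assoc; ++-identityʳ; map-++; mapMaybe-++; mapMaybe-map; upTo-∷ʳ; length-++; length-map)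
open import Data.List.Relation.Binary.Sublist.Propositional using (_⊆_; []; _∷_; _∷ʳ_; ⊆-refl; ⊆-trans)
open import Data.List.Relation.Binary.Sublist.Propositional.Properties using (++⁺ʳ; ++⁺ˡ)
open import Data.List.Relation.Unary.All as All using (All; []; _∷_)
import Data.List.Relation.Unary.All.Properties as All
open import Data.List.Relation.Unary.AllPairs using (AllPairs; []; _∷_)
open import Data.List.Relation.Unary.Any as Any using (here; there)
import Data.List.Relation.Unary.Any.Properties as Any
open import Data.List.Relation.Unary.Linked.Properties using (Linked⇒AllPairs)
open import Data.Maybe using (Maybe; just; nothing)
open import Data.Nat using (ℕ; zero; suc; pred; _+_; _*_; _∸_; _^_; _⊓_; _⊔_; _≤_; _<_; z≤n; s≤s; _≤?_; _<?_; _≤ᵇ_; _<ᵇ_; _≡ᵇ_)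
open import Data.Nat.ListAction using (sum)
open import Data.Nat.ListAction.Properties using (sum-++)
open import Data.Nat.Logarithm using (⌊log₂_⌋; ⌊log₂⌋-mono-≤; ⌊log₂[2^n]⌋≡n)
open import Data.Nat.Properties
open import Data.Nat.Tactic.RingSolver using (solve-∀)
open import Data.Product using (_×_; _,_; proj₁; proj₂; map₁; ∃-syntax)
open import Data.Sum using (_⊎_; inj₁; inj₂)
open import Function using (_∘_; id)
open import Function.Bundles using (Equivalence)
open import Relation.Binary.Definitions using (tri<; tri≈; tri>)
open import Relation.Binary.PropositionalEquality using (_≡_; refl; sym; trans; cong; cong₂; subst; subst₂; module ≡-Reasoning)
open import Relation.Nullary using (¬_; Dec; yes; no; contradiction)
open import Relation.Nullary.Decidable using (T?; _×-dec_)

-- Averaging over shifts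

Σ< : ℕ → (ℕ → ℕ) → ℕ
Σ< zero    f = 0
Σ< (suc n) f = f n + Σ< n f

Σ<-mono : ∀ n {f g} → (∀ i → i < n → f i ≤ g i) → Σ< n f ≤ Σ< n g
Σ<-mono zero    f≤g = z≤n
Σ<-mono (suc n) f≤g =
  +-mono-≤ (f≤g n (n<1+n n)) (Σ<-mono n (λ i i<n → f≤g i (m<n⇒m<1+n i<n)))

Σ<-+ : ∀ n f g → Σ< n (λ i → f i + g i) ≡ Σ< n f + Σ< n g
Σ<-+ zero    f g = refl
Σ<-+ (suc n) f g rewrite Σ<-+ n f g = interchange (f n) (g n) (Σ< n f) (Σ< n g)
  where
  interchange : ∀ a b c d → a + b + (c + d) ≡ a + c + (b + d)
  interchange = solve-∀

Σ<-const : ∀ n c → Σ< n (λ _ → c) ≡ n * c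
Σ<-const zero    c = refl
Σ<-const (suc n) c = cong (c +_) (Σ<-const n c)

Σ<-*ˡ : ∀ n c f → Σ< n (λ i → c * f i) ≡ c * Σ< n f
Σ<-*ˡ zero    c f = sym (*-zeroʳ c)
Σ<-*ˡ (suc n) c f rewrite Σ<-*ˡ n c f = sym (*-distribˡ-+ c (f n) (Σ< n f))

Σ<-zero : ∀ n {f} → (∀ i → i < n → f i ≤ 0) → Σ< n f ≤ 0
Σ<-zero n f≤0 = ≤-trans (Σ<-mono n f≤0) (≤-reflexive (trans (Σ<-const n 0) (*-zeroʳ n)))

Σ<-swap : ∀ m n (f : ℕ → ℕ → ℕ) →
  Σ< m (λ i → Σ< n (f i)) ≡ Σ< n (λ j → Σ< m (λ i → f i j))
Σ<-swap zero    n f = sym (trans (Σ<-const n 0) (*-zeroʳ n))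
Σ<-swap (suc m) n f rewrite Σ<-swap m n f =
  sym (Σ<-+ n (f m) (λ j → Σ< m (λ i → f i j)))

Σ<-split : ∀ m n f → Σ< (m + n) f ≡ Σ< m (λ i → f (i + n)) + Σ< n f
Σ<-split zero    n f = refl
Σ<-split (suc m) n f rewrite Σ<-split m n f = sym (+-assoc (f (m + n)) _ _)

𝟙 : {P : Set} → Dec P → ℕ
𝟙 (yes _) = 1
𝟙 (no _)  = 0

𝟙≤ : {P : Set} (P? : Dec P) {k : ℕ} → (P → 1 ≤ k) → 𝟙 P? ≤ k
𝟙≤ (yes p) h = h p
𝟙≤ (no _)  h = z≤n

1≤𝟙 : {P : Set} (P? : Dec P) → P → 1 ≤ 𝟙 P?
1≤𝟙 (yes _) p = ≤-refl
1≤𝟙 (no ¬p) p = contradiction p ¬p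

𝟙≤0 : {P : Set} (P? : Dec P) → ¬ P → 𝟙 P? ≤ 0
𝟙≤0 P? ¬p = 𝟙≤ P? (λ p → contradiction p ¬p)

Σ<-atMostOne : ∀ n {P : ℕ → Set} (P? : ∀ i → Dec (P i)) →
  (∀ {i j} → i < j → P i → ¬ P j) → Σ< n (λ i → 𝟙 (P? i)) ≤ 1
Σ<-atMostOne zero    P? sep = z≤n
Σ<-atMostOne (suc n) P? sep with P? n
... | yes p = s≤s (Σ<-zero n (λ i i<n → 𝟙≤0 (P? i) (λ q → sep i<n q p)))
... | no _  = Σ<-atMostOne n P? sep

inWindow? : ∀ c w s → Dec (s < c × c ≤ s + w)
inWindow? c w s = s <? c ×-dec c ≤? s + w

-- Serves `count-window` at a shift `n` inside the window: the counted shifts below `n` lie at or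
-- above `c - w`, which leaves `n + w - c` of them and room for the unit added at `n`.
count-window-start : ∀ n c w → Σ< n (λ s → 𝟙 (inWindow? c w s)) ≤ n + w ∸ c
count-window-start zero    c w = z≤n
count-window-start (suc n) c w with inWindow? c w n
... | yes (_ , c≤n+w) =
  ≤-trans (s≤s (count-window-start n c w)) (≤-reflexive (sym (+-∸-assoc 1 c≤n+w)))
... | no _ = ≤-trans (count-window-start n c w) (∸-monoˡ-≤ c (n≤1+n (n + w)))

count-window : ∀ n c w → Σ< n (λ s → 𝟙 (inWindow? c w s)) ≤ w
count-window zero    c w = z≤n
count-window (suc n) c w with inWindow? c w n
... | yes (n<c , c≤n+w) = begin
    suc (Σ< n (λ s → 𝟙 (inWindow? c w s)))  ≤⟨ s≤s (count-window-start n c w) ⟩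
    suc (n + w ∸ c)                         ≡⟨ +-∸-assoc 1 c≤n+w ⟨
    suc n + w ∸ c                           ≤⟨ ∸-monoʳ-≤ (suc n + w) n<c ⟩
    suc n + w ∸ suc n                       ≡⟨ m+n∸m≡n (suc n) w ⟩
    w                                       ∎
  where open ≤-Reasoning
... | no _ = count-window n c w

-- The leaves lie in [a , a + w); w measures the range of keys, not the number of leaves.
data Fits : ℕ → Tree → ℕ → Set where
  leaf : ∀ {a v w} → a ≤ v → v < a + w → Fits a (leaf v) w
  node : ∀ {a L R l r} → Fits a L l → Fits (a + l) R r → Fits a (node L R) (l + r)

leaf-width : ∀ {a v w} → a ≤ v → v < a + w → 1 ≤ w
leaf-width {a} {v} {w} a≤v v<a+w = +-cancelˡ-≤ a 1 w (begin
    a + 1    ≡⟨ +-comm a 1 ⟩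
    suc a    ≤⟨ s≤s a≤v ⟩
    suc v    ≤⟨ v<a+w ⟩
    a + w    ∎)
  where open ≤-Reasoning

inRange? : ∀ a w v → Dec (a ≤ v × v < a + w)
inRange? a w v = a ≤? v ×-dec v <? a + w

-- Keys of a round in an interval, and the amortised cost of a tree

module Counting (d : ℕ) where

  cnt : ℕ → ℕ → ℕ → ℕ
  cnt s a w = Σ< d (λ i → 𝟙 (inRange? a w (s + 2 ^ i)))

  cnt≤d : ∀ s a w → cnt s a w ≤ d
  cnt≤d s a w = ≤-trans (Σ<-mono d (λ i _ → 𝟙≤ (inRange? a w (s + 2 ^ i)) (λ _ → ≤-refl)))
    (≤-reflexive (trans (Σ<-const d 1) (*-identityʳ d)))

  cnt-split : ∀ s a l r → cnt s a l + cnt s (a + l) r ≤ cnt s a (l + r)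
  cnt-split s a l r = ≤-trans (≤-reflexive (sym (Σ<-+ d _ _))) (Σ<-mono d (λ i _ → step (s + 2 ^ i)))
    where
    step : ∀ v → 𝟙 (inRange? a l v) + 𝟙 (inRange? (a + l) r v) ≤ 𝟙 (inRange? a (l + r) v)
    step v with inRange? a l v | inRange? (a + l) r v
    ... | yes (_ , v<) | yes (≤v , _) = contradiction (<-≤-trans v< ≤v) (<-irrefl refl)
    ... | yes (a≤v , v<) | no _ = 1≤𝟙 (inRange? a (l + r) v) (a≤v , <-≤-trans v< (+-monoʳ-≤ a (m≤m+n l r)))
    ... | no _ | yes (≤v , v<) = 1≤𝟙 (inRange? a (l + r) v) (≤-trans (m≤m+n a l) ≤v , subst (v <_) (+-assoc a l r) v<)
    ... | no _ | no _ = z≤n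

  double-^ : ∀ {i j} → i < j → 2 ^ i + 2 ^ i ≤ 2 ^ j
  double-^ {i} i<j = ≤-trans (≤-reflexive (cong (2 ^ i +_) (sym (+-identityʳ (2 ^ i))))) (^-monoʳ-≤ 2 i<j)

  -- Every key of the round exceeds `s`, so the separation condition holds vacuously. The bound 1 is
  -- the shape shared by the three lemmas that make the minimum minus one vanish.
  cnt-before : ∀ {s a l} → a + l ≤ s → cnt s a l ≤ 1
  cnt-before {s} {a} {l} c≤s = Σ<-atMostOne d _
    (λ {i} _ p _ → <-irrefl refl (<-≤-trans (proj₂ p) (≤-trans c≤s (m≤m+n s (2 ^ i)))))

  -- Of two keys the smaller is at most halfway from s to the larger, so two keys close
  -- together cannot be far from s.
  cnt-farˡ : ∀ {s a l} → s + (l + l) < a + l → cnt s a l ≤ 1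
  cnt-farˡ {s} {a} {l} far = Σ<-atMostOne d _ sep
    where
    open ≤-Reasoning
    e₁ : ∀ a l → a + l + (a + l) ≡ a + a + (l + l)
    e₁ = solve-∀
    e₂ : ∀ s p l → s + p + (s + p) + (l + l) ≡ (s + (p + p)) + (s + (l + l))
    e₂ = solve-∀
    sep : ∀ {i j} → i < j → a ≤ s + 2 ^ i × s + 2 ^ i < a + l → ¬ (a ≤ s + 2 ^ j × s + 2 ^ j < a + l)
    sep {i} {j} i<j (a≤ , _) (_ , <c) = <-irrefl refl (begin-strict
      a + l + (a + l)                            ≡⟨ e₁ a l ⟩
      a + a + (l + l)                            ≤⟨ +-monoˡ-≤ (l + l) (+-mono-≤ a≤ a≤) ⟩
      s + 2 ^ i + (s + 2 ^ i) + (l + l)          ≡⟨ e₂ s (2 ^ i) l ⟩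
      (s + (2 ^ i + 2 ^ i)) + (s + (l + l))      ≤⟨ +-monoˡ-≤ _ (+-monoʳ-≤ s (double-^ i<j)) ⟩
      (s + 2 ^ j) + (s + (l + l))                <⟨ +-mono-< <c far ⟩
      a + l + (a + l)                            ∎)

  -- The smaller key lies at least `c - s` above `s`. Doubling this distance puts the larger key at
  -- least `c - s` above `c`, past the end of the interval.
  cnt-farʳ : ∀ {s c r} → s + (r + r) < c → cnt s c r ≤ 1
  cnt-farʳ {s} {c} {r} far = Σ<-atMostOne d _ sep
    where
    open ≤-Reasoning
    e : ∀ s p → s + p + (s + p) ≡ s + (s + (p + p))
    e = solve-∀
    e′ : ∀ s c r → s + (c + r) ≡ s + r + c
    e′ = solve-∀
    sep : ∀ {i j} → i < j → c ≤ s + 2 ^ i × s + 2 ^ i < c + r → ¬ (c ≤ s + 2 ^ j × s + 2 ^ j < c + r)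
    sep {i} {j} i<j (c≤ , _) (_ , <b) = <-irrefl refl (begin-strict
      c + c                         ≤⟨ +-mono-≤ c≤ c≤ ⟩
      s + 2 ^ i + (s + 2 ^ i)       ≡⟨ e s (2 ^ i) ⟩
      s + (s + (2 ^ i + 2 ^ i))     ≤⟨ +-monoʳ-≤ s (+-monoʳ-≤ s (double-^ i<j)) ⟩
      s + (s + 2 ^ j)               <⟨ +-monoʳ-< s <b ⟩
      s + (c + r)                   ≡⟨ e′ s c r ⟩
      s + r + c                     ≤⟨ +-monoˡ-≤ c (+-monoʳ-≤ s (m≤m+n r r)) ⟩
      s + (r + r) + c               <⟨ +-monoˡ-< c far ⟩
      c + c                         ∎)

  -- The conditions on `s` alone confine it to windows of lengths `2 l` and `2 r` below the cut, the
  -- only shifts at which both parts can hold two keys. The last condition puts the key with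
  -- exponent `i` into the right part, so that summing over `i` counts that part's keys.
  Crossing : ℕ → ℕ → ℕ → ℕ → ℕ → Set
  Crossing a l r s i = (s < a + l × a + l ≤ s + (l + l)) × (a + l ≤ s + (r + r))
    × (a + l ≤ s + 2 ^ i × s + 2 ^ i < a + l + r)

  crossing? : ∀ a l r s i → Dec (Crossing a l r s i)
  crossing? a l r s i = inWindow? (a + l) (l + l) s ×-dec a + l ≤? s + (r + r)
    ×-dec inRange? (a + l) r (s + 2 ^ i)

  -- Outside the windows one of the two counts is at most 1 and the left side vanishes. Inside them
  -- every key of the right part is a crossing, and the minimum is at most their number.
  min∸1≤crossings : ∀ a l r s →
    cnt s a l ⊓ cnt s (a + l) r ∸ 1 ≤ Σ< d (λ i → 𝟙 (crossing? a l r s i))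
  min∸1≤crossings a l r s with s <? a + l | a + l ≤? s + (l + l) | a + l ≤? s + (r + r)
  ... | no s≮c | _ | _ = ≤-trans (∸-monoˡ-≤ 1 (≤-trans (m⊓n≤m _ _) (cnt-before {s} {a} {l} (≮⇒≥ s≮c)))) z≤n
  ... | yes _ | no ≰ | _ = ≤-trans (∸-monoˡ-≤ 1 (≤-trans (m⊓n≤m _ _) (cnt-farˡ {s} {a} {l} (≰⇒> ≰)))) z≤n
  ... | yes _ | yes _ | no ≰ =
    ≤-trans (∸-monoˡ-≤ 1 (≤-trans (m⊓n≤n (cnt s a l) _) (cnt-farʳ {s} {a + l} {r} (≰⇒> ≰)))) z≤n
  ... | yes s<c | yes c≤ˡ | yes c≤ʳ =
    ≤-trans (m∸n≤m _ 1) (≤-trans (m⊓n≤n (cnt s a l) _) (Σ<-mono d (λ i _ →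
      𝟙≤ (inRange? (a + l) r (s + 2 ^ i)) (λ q → 1≤𝟙 _ ((s<c , c≤ˡ) , c≤ʳ , q)))))

  2x≤4x : ∀ x → x + x ≤ 4 * x
  2x≤4x x = +-monoʳ-≤ x (m≤m+n x _)

  -- Here `p` is a power of two and `q` the number of shifts charged to it. If `p ≤ 4 * l`, the term
  -- of the whole exceeds those of the parts by exactly `p ⊓ (4 * r)`; symmetrically if `p ≤ 4 * r`.
  -- If `p` is above both, averaging gives `l + l + r ≤ p`, and nothing has to be paid.
  pow-gain : ∀ p l r {q} → q ≤ p → q ≤ l + l → q ≤ r + r → (l + l + r ≤ p → q ≤ 0) →
    q + ((4 * l ∸ p) + (4 * r ∸ p)) ≤ 4 * (l + r) ∸ p
  pow-gain p l r {q} q≤p q≤l q≤r small with p ≤? 4 * l | p ≤? 4 * r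
  ... | yes p≤L | _ = begin
      q + ((4 * l ∸ p) + (4 * r ∸ p))              ≤⟨ +-monoˡ-≤ _ (⊓-glb q≤p (≤-trans q≤r (2x≤4x r))) ⟩
      p ⊓ (4 * r) + ((4 * l ∸ p) + (4 * r ∸ p))      ≡⟨ e (p ⊓ (4 * r)) (4 * l ∸ p) (4 * r ∸ p) ⟩
      4 * l ∸ p + (p ⊓ (4 * r) + (4 * r ∸ p))        ≡⟨ cong (4 * l ∸ p +_) (m⊓n+n∸m≡n p (4 * r)) ⟩
      4 * l ∸ p + 4 * r                            ≡⟨ +-∸-comm (4 * r) p≤L ⟨
      4 * l + 4 * r ∸ p                            ≡⟨ cong (_∸ p) (*-distribˡ-+ 4 l r) ⟨
      4 * (l + r) ∸ p                              ∎
    where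
    open ≤-Reasoning
    e : ∀ x y z → x + (y + z) ≡ y + (x + z)
    e = solve-∀
  ... | no _ | yes p≤R = begin
      q + ((4 * l ∸ p) + (4 * r ∸ p))              ≤⟨ +-monoˡ-≤ _ (⊓-glb q≤p (≤-trans q≤l (2x≤4x l))) ⟩
      p ⊓ (4 * l) + ((4 * l ∸ p) + (4 * r ∸ p))      ≡⟨ +-assoc (p ⊓ (4 * l)) (4 * l ∸ p) (4 * r ∸ p) ⟨
      p ⊓ (4 * l) + (4 * l ∸ p) + (4 * r ∸ p)        ≡⟨ cong (_+ (4 * r ∸ p)) (m⊓n+n∸m≡n p (4 * l)) ⟩
      4 * l + (4 * r ∸ p)                          ≡⟨ +-∸-assoc (4 * l) p≤R ⟨
      4 * l + 4 * r ∸ p                            ≡⟨ cong (_∸ p) (*-distribˡ-+ 4 l r) ⟨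
      4 * (l + r) ∸ p                              ∎
    where open ≤-Reasoning
  ... | no p≰L | no p≰R = begin
      q + ((4 * l ∸ p) + (4 * r ∸ p))   ≤⟨ +-monoˡ-≤ _ (small big) ⟩
      (4 * l ∸ p) + (4 * r ∸ p)         ≡⟨ cong₂ _+_ (m≤n⇒m∸n≡0 (<⇒≤ (≰⇒> p≰L))) (m≤n⇒m∸n≡0 (<⇒≤ (≰⇒> p≰R))) ⟩
      0                                 ≤⟨ z≤n ⟩
      4 * (l + r) ∸ p                   ∎
    where
    open ≤-Reasoning
    e : ∀ l r → 2 * (l + l + r) + 2 * r ≡ 4 * l + 4 * r
    e = solve-∀
    e2 : ∀ p → p + p ≡ 2 * p
    e2 = solve-∀
    big : l + l + r ≤ p
    big = *-cancelˡ-≤ 2 (begin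
      2 * (l + l + r)            ≤⟨ m≤m+n _ (2 * r) ⟩
      2 * (l + l + r) + 2 * r    ≡⟨ e l r ⟩
      4 * l + 4 * r              ≤⟨ +-mono-≤ (<⇒≤ (≰⇒> p≰L)) (<⇒≤ (≰⇒> p≰R)) ⟩
      p + p                      ≡⟨ e2 p ⟩
      2 * p                      ∎)

  Φ : ℕ → ℕ
  Φ w = Σ< d (λ i → 4 * w ∸ 2 ^ i)

  Φ≤ : ∀ w → Φ w ≤ d * (4 * w)
  Φ≤ w = ≤-trans (Σ<-mono d (λ i _ → m∸n≤m (4 * w) (2 ^ i))) (≤-reflexive (Σ<-const d (4 * w)))

  -- Exchanging the sums over shifts and exponents leaves one inequality per exponent, an instance
  -- of `pow-gain`.
  node-crossings : ∀ n a l r →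
    Σ< n (λ s → cnt s a l ⊓ cnt s (a + l) r ∸ 1) + (Φ l + Φ r) ≤ Φ (l + r)
  node-crossings n a l r = begin
      Σ< n (λ s → cnt s a l ⊓ cnt s (a + l) r ∸ 1) + (Φ l + Φ r)
        ≤⟨ +-monoˡ-≤ _ (Σ<-mono n (λ s _ → min∸1≤crossings a l r s)) ⟩
      Σ< n (λ s → Σ< d (λ i → 𝟙 (crossing? a l r s i))) + (Φ l + Φ r)
        ≡⟨ cong₂ _+_ (Σ<-swap n d _) (sym (Σ<-+ d _ _)) ⟩
      Σ< d q + Σ< d (λ i → (4 * l ∸ 2 ^ i) + (4 * r ∸ 2 ^ i))
        ≡⟨ Σ<-+ d _ _ ⟨
      Σ< d (λ i → q i + ((4 * l ∸ 2 ^ i) + (4 * r ∸ 2 ^ i)))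
        ≤⟨ Σ<-mono d (λ i _ → pow-gain (2 ^ i) l r (q≤p i) (q≤l i) (q≤r i) (q≤0 i)) ⟩
      Φ (l + r) ∎
    where
    open ≤-Reasoning
    c = a + l
    q : ℕ → ℕ
    q i = Σ< n (λ s → 𝟙 (crossing? a l r s i))
    q≤w : ∀ i w → (∀ {s} → Crossing a l r s i → s < c × c ≤ s + w) → q i ≤ w
    q≤w i w imp = ≤-trans
      (Σ<-mono n (λ s _ → 𝟙≤ (crossing? a l r s i) (λ x → 1≤𝟙 (inWindow? c w s) (imp x))))
      (count-window n c w)
    -- The key `s + 2 ^ i` reaches `c`, so `s` is within `2 ^ i` below `c`.
    q≤p : ∀ i → q i ≤ 2 ^ i
    q≤p i = q≤w i _ (λ ((s<c , _) , _ , c≤ , _) → s<c , c≤)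
    q≤l : ∀ i → q i ≤ l + l
    q≤l i = q≤w i _ (λ (w , _) → w)
    q≤r : ∀ i → q i ≤ r + r
    q≤r i = q≤w i _ (λ ((s<c , _) , c≤ , _) → s<c , c≤)
    -- A crossing has `c ≤ s + 2 l` and `s + 2 ^ i < c + r`, which forces `2 ^ i < 2 l + r`.
    q≤0 : ∀ i → l + l + r ≤ 2 ^ i → q i ≤ 0
    q≤0 i big = Σ<-zero n (λ s _ → 𝟙≤0 (crossing? a l r s i)
      (λ ((_ , c≤) , _ , _ , <b) → <-irrefl refl (begin-strict
        s + 2 ^ i          <⟨ <b ⟩
        c + r              ≤⟨ +-monoˡ-≤ r c≤ ⟩
        s + (l + l) + r    ≡⟨ +-assoc s (l + l) r ⟩
        s + (l + l + r)    ≤⟨ +-monoʳ-≤ s big ⟩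
        s + 2 ^ i          ∎)))

  -- Both recurse on the derivation of `Fits`, since it records the cut points and widths that the
  -- tree does not.
  minCost excess : ∀ {a t w} → ℕ → Fits a t w → ℕ
  minCost s (leaf _ _) = 0
  minCost s (node {a} {l = l} {r} F G) = cnt s a l ⊓ cnt s (a + l) r + (minCost s F + minCost s G)
  excess s (leaf _ _) = 0
  excess s (node {a} {l = l} {r} F G) = cnt s a l ⊓ cnt s (a + l) r ∸ 1 + (excess s F + excess s G)

  min+pred+pred : ∀ A B → A ⊓ B + (pred A + pred B) ≤ (A ⊓ B ∸ 1) + pred (A + B)
  min+pred+pred zero    B       = ≤-refl
  min+pred+pred (suc A) zero    = ≤-reflexive refl
  min+pred+pred (suc A) (suc B) = ≤-reflexive (e (A ⊓ B) A B)
    where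
    e : ∀ m A B → suc m + (A + B) ≡ m + (A + suc B)
    e = solve-∀

  -- A unit is dropped only at a node with keys in both parts, and there `pred (A + B)` exceeds
  -- `pred A + pred B` by one. The dropped units thus telescope to one less than the number of keys
  -- at the root.
  minCost≤ : ∀ {a t w} s (F : Fits a t w) → minCost s F ≤ excess s F + pred (cnt s a w)
  minCost≤ s (leaf _ _) = z≤n
  minCost≤ s (node {a} {l = l} {r} F G) = begin
      A ⊓ B + (minCost s F + minCost s G)
        ≤⟨ +-monoʳ-≤ (A ⊓ B) (+-mono-≤ (minCost≤ s F) (minCost≤ s G)) ⟩
      A ⊓ B + (excess s F + pred A + (excess s G + pred B))
        ≡⟨ e (A ⊓ B) (excess s F) (pred A) (excess s G) (pred B) ⟩
      A ⊓ B + (pred A + pred B) + (excess s F + excess s G)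
        ≤⟨ +-monoˡ-≤ _ (min+pred+pred A B) ⟩
      (A ⊓ B ∸ 1) + pred (A + B) + (excess s F + excess s G)
        ≤⟨ +-monoˡ-≤ _ (+-monoʳ-≤ (A ⊓ B ∸ 1) (pred-mono-≤ (cnt-split s a l r))) ⟩
      (A ⊓ B ∸ 1) + pred (cnt s a (l + r)) + (excess s F + excess s G)
        ≡⟨ e′ (A ⊓ B ∸ 1) (pred (cnt s a (l + r))) (excess s F + excess s G) ⟩
      (A ⊓ B ∸ 1) + (excess s F + excess s G) + pred (cnt s a (l + r)) ∎
    where
    open ≤-Reasoning
    A = cnt s a l
    B = cnt s (a + l) r
    e : ∀ m x p y q → m + (x + p + (y + q)) ≡ m + (p + q) + (x + y)
    e = solve-∀
    e′ : ∀ m p z → m + p + z ≡ m + z + p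
    e′ = solve-∀

  -- Telescopes: each node is charged the rise of the potential from its two parts to the whole, and
  -- the potential left over at the leaves is nonnegative.
  Σ-excess≤Φ : ∀ {a t w} n (F : Fits a t w) → Σ< n (λ s → excess s F) ≤ Φ w
  Σ-excess≤Φ n (leaf _ _) = ≤-trans (≤-reflexive (trans (Σ<-const n 0) (*-zeroʳ n))) z≤n
  Σ-excess≤Φ n (node {a} {l = l} {r} F G) = begin
      Σ< n (λ s → h s + (excess s F + excess s G))
        ≡⟨ trans (Σ<-+ n h _) (cong (Σ< n h +_) (Σ<-+ n _ _)) ⟩
      Σ< n h + (Σ< n (λ s → excess s F) + Σ< n (λ s → excess s G))
        ≤⟨ +-monoʳ-≤ (Σ< n h) (+-mono-≤ (Σ-excess≤Φ n F) (Σ-excess≤Φ n G)) ⟩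
      Σ< n h + (Φ l + Φ r)
        ≤⟨ node-crossings n a l r ⟩
      Φ (l + r) ∎
    where
    open ≤-Reasoning
    h : ℕ → ℕ
    h s = cnt s a l ⊓ cnt s (a + l) r ∸ 1

  Σ-minCost≤ : ∀ {a t w} n (F : Fits a t w) → Σ< n (λ s → minCost s F) ≤ d * (4 * w) + n * d
  Σ-minCost≤ {a} {t} {w} n F = begin
      Σ< n (λ s → minCost s F)
        ≤⟨ Σ<-mono n (λ s _ → ≤-trans (minCost≤ s F)
             (+-monoʳ-≤ (excess s F) (≤-trans (pred[n]≤n {cnt s a w}) (cnt≤d s a w)))) ⟩
      Σ< n (λ s → excess s F + d)
        ≡⟨ trans (Σ<-+ n _ _) (cong (Σ< n (λ s → excess s F) +_) (Σ<-const n d)) ⟩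
      Σ< n (λ s → excess s F) + n * d
        ≤⟨ +-monoˡ-≤ (n * d) (≤-trans (Σ-excess≤Φ n F) (Φ≤ w)) ⟩
      d * (4 * w) + n * d ∎
    where open ≤-Reasoning

-- Funnel words and bit reversal

-- A triangle inequality: a detour through `b` between `a` and the rest of the word never saves a
-- change.
changes-via : ∀ a b w → changes a w ≤ changes a (b ∷ w)
changes-via a     b     []          = z≤n
changes-via true  true  w@(_ ∷ _)   = ≤-refl
changes-via false false w@(_ ∷ _)   = ≤-refl
changes-via true  false (true ∷ w)  = m≤n+m (changes true w) 2
changes-via true  false (false ∷ w) = ≤-refl
changes-via false true  (true ∷ w)  = ≤-refl
changes-via false true  (false ∷ w) = m≤n+m (changes false w) 2

changes-⊆ : ∀ a {u w} → u ⊆ w → changes a u ≤ changes a w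
changes-⊆ a []           = z≤n
changes-⊆ a {u} (b ∷ʳ τ) = ≤-trans (changes-via a b u) (+-monoʳ-≤ _ (changes-⊆ b τ))
changes-⊆ a (refl ∷ τ)   = +-monoʳ-≤ _ (changes-⊆ _ τ)

blocks-∷ : ∀ b w → blocks w ≤ blocks (b ∷ w)
blocks-∷ b []      = z≤n
blocks-∷ b (a ∷ w) = s≤s (m≤n+m (changes a w) _)

-- Lets a lower bound on a funnel exhibit only some of the letters of its word.
blocks-⊆ : ∀ {u w} → u ⊆ w → blocks u ≤ blocks w
blocks-⊆ []                   = z≤n
blocks-⊆ {w = b ∷ w} (b ∷ʳ τ) = ≤-trans (blocks-⊆ τ) (blocks-∷ b w)
blocks-⊆ (_∷_ {x} refl τ)     = s≤s (changes-⊆ x τ)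

changes-++ : ∀ a u v → changes a (u ++ v) ≤ changes a u + blocks v
changes-++ a []      []      = z≤n
changes-++ true  [] (true ∷ v)  = n≤1+n _
changes-++ true  [] (false ∷ v) = ≤-refl
changes-++ false [] (true ∷ v)  = ≤-refl
changes-++ false [] (false ∷ v) = n≤1+n _
changes-++ a (b ∷ u) v       =
  ≤-trans (+-monoʳ-≤ _ (changes-++ b u v)) (≤-reflexive (sym (+-assoc _ (changes b u) (blocks v))))

blocks-++ : ∀ u v → blocks (u ++ v) ≤ blocks u + blocks v
blocks-++ []      v = ≤-refl
blocks-++ (a ∷ u) v = s≤s (changes-++ a u v)

changes-∷ʳ-turn : ∀ a w b → changes a ((w ++ b ∷ []) ++ not b ∷ []) ≡ suc (changes a (w ++ b ∷ []))
changes-∷ʳ-turn true  []      true  = refl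
changes-∷ʳ-turn true  []      false = refl
changes-∷ʳ-turn false []      true  = refl
changes-∷ʳ-turn false []      false = refl
changes-∷ʳ-turn a     (c ∷ w) b     rewrite changes-∷ʳ-turn c w b = +-suc _ _

blocks-∷ʳ-turn : ∀ w b → blocks ((w ++ b ∷ []) ++ not b ∷ []) ≡ suc (blocks (w ++ b ∷ []))
blocks-∷ʳ-turn []      true  = refl
blocks-∷ʳ-turn []      false = refl
blocks-∷ʳ-turn (a ∷ w) b     = cong suc (changes-∷ʳ-turn a w b)

_∷?_ : {A : Set} → Maybe A → List A → List A
just a  ∷? w = a ∷ w
nothing ∷? w = w

⊆-∷? : ∀ {A : Set} (m : Maybe A) {u w} → u ⊆ w → u ⊆ m ∷? w
⊆-∷? (just a) τ = a ∷ʳ τ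
⊆-∷? nothing  τ = τ

∷?-⊆ : ∀ {A : Set} (m : Maybe A) {u w} → u ⊆ w → m ∷? u ⊆ m ∷? w
∷?-⊆ (just a) τ = refl ∷ τ
∷?-⊆ nothing  τ = τ

∷?-++ : ∀ {A : Set} (m : Maybe A) u w → m ∷? (u ++ w) ≡ (m ∷? u) ++ w
∷?-++ (just a) u w = refl
∷?-++ nothing  u w = refl

outside : ℕ → ℕ → ℕ → Bool
outside a b v = not ((a ≤ᵇ v) ∧ (v ≤ᵇ b))

-- The side on which the access z lies in the funnel of a later access to x, where zs are the
-- accesses in between.
letter : ℕ → ℕ → List ℕ → Maybe Bool
letter x z zs =
  if (z <ᵇ x) ∧ all (outside z x) zs then just true
  else if (x <ᵇ z) ∧ all (outside x z) zs then just false
  else nothing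

-- The list is in order of time, so the tail `zs` holds exactly the accesses between `z` and the
-- access to `x`, and the most recent access comes last in the word.
funnelWord : ℕ → List ℕ → List Bool
funnelWord x []       = []
funnelWord x (z ∷ zs) = letter x z zs ∷? funnelWord x zs

T⇒≡ : ∀ {b} → T b → b ≡ true
T⇒≡ = Equivalence.to T-≡

¬T⇒≡ : ∀ {b} → ¬ T b → b ≡ false
¬T⇒≡ {true}  ¬t = contradiction _ ¬t
¬T⇒≡ {false} ¬t = refl

<⇒<ᵇ≡ : ∀ {m n} → m < n → (m <ᵇ n) ≡ true
<⇒<ᵇ≡ m<n = T⇒≡ (<⇒<ᵇ m<n)

≮⇒<ᵇ≡ : ∀ {m n} → ¬ m < n → (m <ᵇ n) ≡ false
≮⇒<ᵇ≡ {m} {n} m≮n = ¬T⇒≡ (m≮n ∘ <ᵇ⇒< m n)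

≤⇒≤ᵇ≡ : ∀ {m n} → m ≤ n → (m ≤ᵇ n) ≡ true
≤⇒≤ᵇ≡ m≤n = T⇒≡ (≤⇒≤ᵇ m≤n)

≰⇒≤ᵇ≡ : ∀ {m n} → ¬ m ≤ n → (m ≤ᵇ n) ≡ false
≰⇒≤ᵇ≡ {m} {n} m≰n = ¬T⇒≡ (m≰n ∘ ≤ᵇ⇒≤ m n)

outside-above : ∀ {a b v} → b < v → outside a b v ≡ true
outside-above {a} {b} {v} b<v rewrite ≰⇒≤ᵇ≡ (<⇒≱ b<v) = cong not (∧-zeroʳ (a ≤ᵇ v))

outside-below : ∀ {a b v} → v < a → outside a b v ≡ true
outside-below v<a rewrite ≰⇒≤ᵇ≡ (<⇒≱ v<a) = refl

outside-self : ∀ {a b v} → a ≤ v → v ≤ b → outside a b v ≡ false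
outside-self a≤v v≤b rewrite ≤⇒≤ᵇ≡ a≤v | ≤⇒≤ᵇ≡ v≤b = refl

letter-cong : ∀ x z zs zs′ → all (outside z x) zs ≡ all (outside z x) zs′ →
  all (outside x z) zs ≡ all (outside x z) zs′ → letter x z zs ≡ letter x z zs′
letter-cong x z zs zs′ p q rewrite p | q = refl

letter-left : ∀ {x z} → z < x → letter x z [] ≡ just true
letter-left z<x rewrite <⇒<ᵇ≡ z<x = refl

letter-right : ∀ {x z} → x < z → letter x z [] ≡ just false
letter-right x<z rewrite ≮⇒<ᵇ≡ (<⇒≯ x<z) | <⇒<ᵇ≡ x<z = refl

all-∷-true : ∀ (p : ℕ → Bool) zs {z b} → p z ≡ true → all p zs ≡ b → all p (z ∷ zs) ≡ b
all-∷-true p zs pz eq rewrite pz = eq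

all-∷ʳ-false : ∀ (p : ℕ → Bool) zs {x} → p x ≡ false → all p (zs ++ x ∷ []) ≡ false
all-∷ʳ-false p []       px rewrite px = refl
all-∷ʳ-false p (z ∷ zs) px rewrite all-∷ʳ-false p zs px = ∧-zeroʳ (p z)

-- The trailing `x` is an endpoint of the key range tested on either side, so it blocks every
-- earlier access.
letter-blocked : ∀ x z zs → letter x z (zs ++ x ∷ []) ≡ nothing
letter-blocked x z zs with z <ᵇ x in z<x | x <ᵇ z in x<z
... | true | b
  rewrite all-∷ʳ-false (outside z x) zs (outside-self (<⇒≤ (<ᵇ⇒< z x (subst T (sym z<x) _))) ≤-refl)
  with b
...   | true rewrite all-∷ʳ-false (outside x z) zs (outside-self ≤-refl (<⇒≤ (<ᵇ⇒< x z (subst T (sym x<z) _)))) = refl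
...   | false = refl
letter-blocked x z zs | false | true
  rewrite all-∷ʳ-false (outside x z) zs (outside-self ≤-refl (<⇒≤ (<ᵇ⇒< x z (subst T (sym x<z) _)))) = refl
letter-blocked x z zs | false | false = refl

<ᵇ-irrefl : ∀ x → (x <ᵇ x) ≡ false
<ᵇ-irrefl x = ≮⇒<ᵇ≡ {x} (<-irrefl refl)

funnelWord-self : ∀ x zs → funnelWord x (zs ++ x ∷ []) ≡ []
funnelWord-self x [] rewrite <ᵇ-irrefl x = refl
funnelWord-self x (z ∷ zs) rewrite letter-blocked x z zs = funnelWord-self x zs

funnelWord-last : ∀ x zs z {b} → letter x z [] ≡ just b → ∃[ w ] funnelWord x (zs ++ z ∷ []) ≡ w ++ b ∷ []
funnelWord-last x []       z eq rewrite eq = [] , refl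
funnelWord-last x (y ∷ zs) z eq with funnelWord-last x zs z eq
... | w , e = letter x y (zs ++ z ∷ []) ∷? w ,
              trans (cong (letter x y (zs ++ z ∷ []) ∷?_) e) (∷?-++ _ w _)

funnelWord-suffix : ∀ x us zs → funnelWord x zs ⊆ funnelWord x (us ++ zs)
funnelWord-suffix x []       zs = ⊆-refl
funnelWord-suffix x (u ∷ us) zs = ⊆-∷? _ (funnelWord-suffix x us zs)

funnelSum : List ℕ → List ℕ → ℕ
funnelSum pre []       = 0
funnelSum pre (x ∷ xs) = blocks (funnelWord x pre) + funnelSum (pre ++ x ∷ []) xs

-- An access is blocked only by later ones, so older accesses merely put letters in front of each
-- funnel word.
funnelSum-weaken : ∀ us pre xs → funnelSum pre xs ≤ funnelSum (us ++ pre) xs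
funnelSum-weaken us pre []       = z≤n
funnelSum-weaken us pre (x ∷ xs) = +-mono-≤ (blocks-⊆ (funnelWord-suffix x us pre))
  (subst (λ p → funnelSum (pre ++ x ∷ []) xs ≤ funnelSum p xs) (sym (++-assoc us pre _))
    (funnelSum-weaken us (pre ++ x ∷ []) xs))

funnelSum-++ : ∀ pre xs ys → funnelSum pre (xs ++ ys) ≡ funnelSum pre xs + funnelSum (pre ++ xs) ys
funnelSum-++ pre []       ys = cong (λ p → funnelSum p ys) (sym (++-identityʳ pre))
funnelSum-++ pre (x ∷ xs) ys rewrite funnelSum-++ (pre ++ x ∷ []) xs ys | ++-assoc pre (x ∷ []) xs =
  sym (+-assoc (blocks (funnelWord x pre)) _ _)

funnelSum-superadditive : ∀ xs ys → funnelSum [] xs + funnelSum [] ys ≤ funnelSum [] (xs ++ ys)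
funnelSum-superadditive xs ys = begin
    funnelSum [] xs + funnelSum [] ys           ≤⟨ +-monoʳ-≤ (funnelSum [] xs) (funnelSum-weaken xs [] ys) ⟩
    funnelSum [] xs + funnelSum (xs ++ []) ys   ≡⟨ cong (λ p → funnelSum [] xs + funnelSum p ys) (++-identityʳ xs) ⟩
    funnelSum [] xs + funnelSum xs ys           ≡⟨ funnelSum-++ [] xs ys ⟨
    funnelSum [] (xs ++ ys)                     ∎
  where open ≤-Reasoning

-- Doubling the index set

interleave : (ℕ → ℕ) → ℕ → List ℕ → List ℕ
interleave f h []      = []
interleave f h (i ∷ I) = f i ∷ f (i + h) ∷ interleave f h I

map-interleave : ∀ f h I → map f (interleave id h I) ≡ interleave f h I
map-interleave f h []      = refl
map-interleave f h (i ∷ I) = cong (λ J → f i ∷ f (i + h) ∷ J) (map-interleave f h I)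

interleave-++ : ∀ f h I J → interleave f h (I ++ J) ≡ interleave f h I ++ interleave f h J
interleave-++ f h []      J = refl
interleave-++ f h (i ∷ I) J = cong (λ K → f i ∷ f (i + h) ∷ K) (interleave-++ f h I J)

module Doubling (f : ℕ → ℕ) (f-mono : ∀ {i j} → i < j → f i < f j) (h : ℕ) where

  f′ : ℕ → ℕ
  f′ i = f (i + h)

  D : List ℕ → List ℕ
  D = interleave f h

  f<f′ : ∀ {i} → i < h → ∀ j → f i < f′ j
  f<f′ i<h j = f-mono (<-≤-trans i<h (m≤n+m h j))

  -- In use, `p` tests a range of keys below the upper half, which no access to an upper key enters.
  all-lower : ∀ p I → (∀ j → p (f′ j) ≡ true) → all p (D I) ≡ all p (map f I)
  all-lower p []      _   = refl
  all-lower p (i ∷ I) pf′ rewrite pf′ i | all-lower p I pf′ = refl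

  all-upper : ∀ p {I k} → All (_< h) I → k < h → (∀ {j} → j < h → p (f j) ≡ true) →
    all p (D I ++ f k ∷ []) ≡ all p (map f′ I)
  all-upper p []          k<h pf rewrite pf k<h = refl
  all-upper p (i<h ∷ I<h) k<h pf rewrite pf i<h | all-upper p I<h k<h pf = refl

  -- Upper keys never block lower ones, so the letters of the lower half survive interleaving. The
  -- last upper access comes right before `x` with nothing in between, and adds a final letter on
  -- the right.
  word-lower : ∀ {x} i I → All (_< h) (i ∷ I) → (∀ j → x < f′ j) →
    funnelWord x (map f (i ∷ I)) ++ false ∷ [] ⊆ funnelWord x (D (i ∷ I))
  word-lower {x} i I (i<h ∷ I<h) x< = subst₂ _⊆_ eqˡ eqʳ (∷?-⊆ (letter x (f i) (map f I)) (tail I I<h))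
    where
    eqˡ = ∷?-++ (letter x (f i) (map f I)) (funnelWord x (map f I)) (false ∷ [])
    eqʳ = cong (_∷? (letter x (f′ i) (D I) ∷? funnelWord x (D I)))
      (letter-cong x (f i) (map f I) (f′ i ∷ D I)
        (sym (all-∷-true (outside (f i) x) (D I) (outside-above {f i} (x< i))
          (all-lower (outside (f i) x) I (λ j → outside-above {f i} (x< j)))))
        (sym (all-∷-true (outside x (f i)) (D I) (outside-above {x} (f<f′ i<h i))
          (all-lower (outside x (f i)) I (λ j → outside-above {x} (f<f′ i<h j))))))
    tail : ∀ I → All (_< h) I →
      funnelWord x (map f I) ++ false ∷ [] ⊆ letter x (f′ i) (D I) ∷? funnelWord x (D I)
    tail []      _   rewrite letter-right (x< i) = refl ∷ []
    tail (j ∷ J) J<h = ⊆-∷? (letter x (f′ i) (D (j ∷ J))) (word-lower j J J<h x<)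

  -- The mirror case: lower keys never block upper ones, and `f k`, accessed right before `x`, adds
  -- a final letter on the left.
  word-upper : ∀ {x k I} → All (_< h) I → k < h → (∀ {j} → j < h → f j < x) →
    funnelWord x (map f′ I) ++ true ∷ [] ⊆ funnelWord x (D I ++ f k ∷ [])
  word-upper [] k<h <x rewrite letter-left (<x k<h) = refl ∷ []
  word-upper {x} {k} {i ∷ I} (i<h ∷ I<h) k<h <x = ⊆-∷? (letter x (f i) (f′ i ∷ D I ++ f k ∷ []))
    (subst₂ _⊆_ (∷?-++ (letter x (f′ i) (map f′ I)) _ _)
      (cong (_∷? funnelWord x (D I ++ f k ∷ []))
        (letter-cong x (f′ i) (map f′ I) (D I ++ f k ∷ [])
          (sym (all-upper (outside (f′ i) x) I<h k<h (λ j<h → outside-below (f<f′ j<h i))))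
          (sym (all-upper (outside x (f′ i)) I<h k<h (λ j<h → outside-below (<x j<h))))))
      (∷?-⊆ (letter x (f′ i) (map f′ I)) (word-upper I<h k<h <x)))

  -- If the previous index was at most i, the funnel of f i within its half does not end on the
  -- right and gains the upper key accessed just before; otherwise the funnel of f′ i within its
  -- half ends on the right and gains f i.
  pair-gain : ∀ {i I} → All (_< h) I → i < h →
    suc (blocks (funnelWord (f i) (map f I)) + blocks (funnelWord (f′ i) (map f′ I)))
      ≤ blocks (funnelWord (f i) (D I)) + blocks (funnelWord (f′ i) (D I ++ f i ∷ []))
  pair-gain {i} {I} I<h i<h with initLast I
  -- For the first pair both words within the halves are empty; the unit comes from `f′ i` seeing
  -- `f i`.
  ... | [] = blocks-⊆ (word-upper {f′ i} [] i<h (λ j<h → f<f′ j<h i))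
  ... | J ∷ʳ′ z = gain (<-cmp z i)
    where
    L = J ++ z ∷ []
    lower upper lower′ upper′ : List Bool
    lower  = funnelWord (f i) (map f L)
    upper  = funnelWord (f′ i) (map f′ L)
    lower′ = funnelWord (f i) (D L)
    upper′ = funnelWord (f′ i) (D L ++ f i ∷ [])
    nonempty : ∀ M → All (_< h) (M ++ z ∷ []) →
      funnelWord (f i) (map f (M ++ z ∷ [])) ++ false ∷ [] ⊆ funnelWord (f i) (D (M ++ z ∷ []))
    nonempty []      M<h = word-lower z [] M<h (f<f′ i<h)
    nonempty (m ∷ M) M<h = word-lower m (M ++ z ∷ []) M<h (f<f′ i<h)
    lower⊆ : lower ++ false ∷ [] ⊆ lower′
    lower⊆ = nonempty J I<h
    upper⊆ : upper ++ true ∷ [] ⊆ upper′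
    upper⊆ = word-upper I<h i<h (λ j<h → f<f′ j<h i)
    lower≤ : blocks lower ≤ blocks lower′
    lower≤ = blocks-⊆ (⊆-trans (++⁺ʳ (false ∷ []) ⊆-refl) lower⊆)
    upper≤ : blocks upper ≤ blocks upper′
    upper≤ = blocks-⊆ (⊆-trans (++⁺ʳ (true ∷ []) ⊆-refl) upper⊆)
    turn : ∀ {w v} b → (∃[ u ] w ≡ u ++ b ∷ []) → w ++ not b ∷ [] ⊆ v → suc (blocks w) ≤ blocks v
    turn b (u , refl) τ = ≤-trans (≤-reflexive (sym (blocks-∷ʳ-turn u b))) (blocks-⊆ τ)
    last : ∀ (g : ℕ → ℕ) x b → letter x (g z) [] ≡ just b → ∃[ u ] funnelWord x (map g L) ≡ u ++ b ∷ []
    last g x b eq = subst (λ M → ∃[ u ] funnelWord x M ≡ u ++ b ∷ []) (sym (map-++ g J (z ∷ [])))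
      (funnelWord-last x (map g J) (g z) eq)
    gain : _ → suc (blocks lower + blocks upper) ≤ blocks lower′ + blocks upper′
    gain (tri< z<i _ _) = +-mono-≤ (turn true (last f (f i) true (letter-left (f-mono z<i))) lower⊆) upper≤
    -- With a repeated index, `f i` itself was the last access in its half, so its word there is
    -- empty and the appended letter is the new block.
    gain (tri≈ _ refl _) = +-mono-≤ (≤-trans (s≤s (≤-reflexive (cong blocks empty))) (≤-trans (blocks-⊆ (⊆-single lower)) (blocks-⊆ lower⊆))) upper≤
      where
      empty : lower ≡ []
      empty = trans (cong (funnelWord (f i)) (map-++ f J (z ∷ []))) (funnelWord-self (f i) (map f J))
      ⊆-single : ∀ w → false ∷ [] ⊆ w ++ false ∷ []
      ⊆-single w = ++⁺ˡ w ⊆-refl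
    gain (tri> _ _ i<z) = ≤-trans (≤-reflexive (sym (+-suc (blocks lower) (blocks upper))))
      (+-mono-≤ lower≤ (turn false (last f′ (f′ i) false (letter-right (f-mono (+-monoˡ-< h i<z)))) upper⊆))

  -- Each pair of accesses gains one block, whence `length J`. The indices `I` already accessed are
  -- carried along because later funnels look back at them.
  funnelSum-double : ∀ I J → All (_< h) I → All (_< h) J →
    funnelSum (map f I) (map f J) + funnelSum (map f′ I) (map f′ J) + length J ≤ funnelSum (D I) (D J)
  funnelSum-double I []      I<h _           = z≤n
  funnelSum-double I (j ∷ J) I<h (j<h ∷ J<h) = begin
      (a + funnelSum (map f I ++ f j ∷ []) (map f J)) + (b + funnelSum (map f′ I ++ f′ j ∷ []) (map f′ J)) + suc (length J)
        ≡⟨ cong₂ (λ P Q → (a + funnelSum P (map f J)) + (b + funnelSum Q (map f′ J)) + suc (length J))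
             (sym (map-++ f I _)) (sym (map-++ f′ I _)) ⟩
      (a + A) + (b + B) + suc (length J)
        ≡⟨ e a A b B (length J) ⟩
      suc (a + b) + (A + B + length J)
        ≤⟨ +-mono-≤ (pair-gain I<h j<h) (funnelSum-double (I ++ j ∷ []) J (All.++⁺ I<h (j<h ∷ [])) J<h) ⟩
      a′ + b′ + funnelSum (D (I ++ j ∷ [])) (D J)
        ≡⟨ cong (λ P → a′ + b′ + funnelSum P (D J))
             (trans (interleave-++ f h I _) (sym (++-assoc (D I) (f j ∷ []) _))) ⟩
      a′ + b′ + funnelSum ((D I ++ f j ∷ []) ++ f′ j ∷ []) (D J)
        ≡⟨ +-assoc a′ b′ _ ⟩
      a′ + (b′ + funnelSum ((D I ++ f j ∷ []) ++ f′ j ∷ []) (D J)) ∎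
    where
    open ≤-Reasoning
    a = blocks (funnelWord (f j) (map f I))
    b = blocks (funnelWord (f′ j) (map f′ I))
    a′ = blocks (funnelWord (f j) (D I))
    b′ = blocks (funnelWord (f′ j) (D I ++ f j ∷ []))
    A = funnelSum (map f (I ++ j ∷ [])) (map f J)
    B = funnelSum (map f′ (I ++ j ∷ [])) (map f′ J)
    e : ∀ a A b B n → (a + A) + (b + B) + suc n ≡ suc (a + b) + (A + B + n)
    e = solve-∀

-- The indices below `2 ^ k` in the order of their reversed binary expansions: 0, then 0 1, then 0 2
-- 1 3, and so on.
bitReversal : ℕ → List ℕ
bitReversal zero    = 0 ∷ []
bitReversal (suc k) = interleave id (2 ^ k) (bitReversal k)

length-bitReversal : ∀ k → length (bitReversal k) ≡ 2 ^ k
length-bitReversal zero    = refl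
length-bitReversal (suc k) = trans (double (bitReversal k)) (cong (2 *_) (length-bitReversal k))
  where
  double : ∀ I → length (interleave id (2 ^ k) I) ≡ 2 * length I
  double []      = refl
  double (i ∷ I) = cong suc (trans (cong suc (double I)) (sym (+-suc (length I) _)))

bitReversal-< : ∀ k → All (_< 2 ^ k) (bitReversal k)
bitReversal-< zero    = s≤s z≤n ∷ []
bitReversal-< (suc k) = bound (bitReversal-< k)
  where
  bound : ∀ {I} → All (_< 2 ^ k) I → All (_< 2 ^ suc k) (interleave id (2 ^ k) I)
  bound []                    = []
  bound {i ∷ _} (i<h ∷ I<h)   = <-≤-trans i<h (m≤m+n (2 ^ k) _) ∷
    subst (i + 2 ^ k <_) (cong (2 ^ k +_) (sym (+-identityʳ (2 ^ k)))) (+-monoˡ-< (2 ^ k) i<h) ∷ bound I<h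

-- Doubling `h` keys to `2 h` doubles the sum and adds `h`, which solves to half of `k * 2 ^ k`. An
-- arbitrary increasing `f` is allowed so that the induction covers both halves.
funnelSum-bitReversal : ∀ k f → (∀ {i j} → i < j → f i < f j) →
  k * 2 ^ k ≤ 2 * funnelSum [] (map f (bitReversal k))
funnelSum-bitReversal zero    f f-mono = z≤n
funnelSum-bitReversal (suc k) f f-mono = begin
    suc k * 2 ^ suc k
      ≡⟨ e k h ⟩
    k * h + k * h + 2 * h
      ≤⟨ +-monoˡ-≤ (2 * h) (+-mono-≤ (funnelSum-bitReversal k f f-mono)
           (funnelSum-bitReversal k f′ (f-mono ∘ +-monoˡ-< h))) ⟩
    2 * A + 2 * B + 2 * h
      ≡⟨ e′ A B h ⟩
    2 * (A + B + h)
      ≡⟨ cong (λ n → 2 * (A + B + n)) (length-bitReversal k) ⟨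
    2 * (A + B + length (bitReversal k))
      ≤⟨ *-monoʳ-≤ 2 (funnelSum-double [] (bitReversal k) [] (bitReversal-< k)) ⟩
    2 * funnelSum [] (interleave f h (bitReversal k))
      ≡⟨ cong (λ X → 2 * funnelSum [] X) (map-interleave f h (bitReversal k)) ⟨
    2 * funnelSum [] (map f (bitReversal (suc k))) ∎
  where
  open ≤-Reasoning
  h = 2 ^ k
  open Doubling f f-mono h
  A = funnelSum [] (map f (bitReversal k))
  B = funnelSum [] (map f′ (bitReversal k))
  e : ∀ k h → suc k * (2 * h) ≡ k * h + k * h + 2 * h
  e = solve-∀
  e′ : ∀ A B h → 2 * A + 2 * B + 2 * h ≡ 2 * (A + B + h)
  e′ = solve-∀

-- The two bounds in terms of access sequences

mapMaybe-∷ : ∀ {A B : Set} (g : A → Maybe B) x l → mapMaybe g (x ∷ l) ≡ g x ∷? mapMaybe g l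
mapMaybe-∷ g x l with g x
... | just _  = refl
... | nothing = refl

mapMaybe-cong-All : ∀ {A B : Set} {g h : A → Maybe B} {l} → All (λ x → g x ≡ h x) l → mapMaybe g l ≡ mapMaybe h l
mapMaybe-cong-All [] = refl
mapMaybe-cong-All {g = g} {h} {x ∷ l} (eq ∷ eqs) = trans (mapMaybe-∷ g x l)
  (trans (cong₂ _∷?_ eq (mapMaybe-cong-All eqs)) (sym (mapMaybe-∷ h x l)))

mapMaybe-upTo-+ : ∀ {B : Set} (g : ℕ → Maybe B) m j → (∀ y → m ≤ y → g y ≡ nothing) →
  mapMaybe g (upTo (j + m)) ≡ mapMaybe g (upTo m)
mapMaybe-upTo-+ g m zero    _    = refl
mapMaybe-upTo-+ g m (suc j) none = begin
    mapMaybe g (upTo (suc j + m))                          ≡⟨ cong (mapMaybe g) (upTo-∷ʳ (j + m)) ⟨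
    mapMaybe g (upTo (j + m) ++ j + m ∷ [])                ≡⟨ mapMaybe-++ g (upTo (j + m)) _ ⟩
    mapMaybe g (upTo (j + m)) ++ mapMaybe g (j + m ∷ [])   ≡⟨ cong₂ _++_ (mapMaybe-upTo-+ g m j none)
                                                               (trans (mapMaybe-∷ g (j + m) []) (cong (_∷? []) (none (j + m) (m≤n+m m j)))) ⟩
    mapMaybe g (upTo m) ++ []                              ≡⟨ ++-identityʳ _ ⟩
    mapMaybe g (upTo m)                                    ∎
  where open ≡-Reasoning

-- Restates the labelling local to `mix`, with which it agrees by computation.
choose : Bool → Bool → Maybe Bool
choose a b = if a then just true else (if b then just false else nothing)

∈ᵇ⇒∈ : ∀ {v} l → T (v ∈ᵇ l) → v ∈ l
∈ᵇ⇒∈ {v} l t = Any.map (λ {z} e → sym (≡ᵇ⇒≡ z v e)) (Any.any⁻ (λ z → z ≡ᵇ v) l t)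

∉⇒∈ᵇ≡ : ∀ {v} l → ¬ v ∈ l → (v ∈ᵇ l) ≡ false
∉⇒∈ᵇ≡ l ∉ = ¬T⇒≡ (∉ ∘ ∈ᵇ⇒∈ l)

∈⇒≤maxList : ∀ {v l} → v ∈ l → v ≤ maxList l
∈⇒≤maxList {l = x ∷ l} (here refl) = m≤m⊔n x (maxList l)
∈⇒≤maxList {l = x ∷ l} (there v∈)  = ≤-trans (∈⇒≤maxList v∈) (m≤n⊔m x (maxList l))

select : (Point → Bool) → List Point → List Point
select φ = filter (λ p → T? (φ p))

select-ys-bounds : ∀ φ k X {y} → y ∈ ys (select φ (Gfrom k X)) → k ≤ y × y < k + length X
select-ys-bounds φ k (x ∷ X) y∈ with φ (x , k) | y∈
... | true  | here refl = ≤-refl , m<m+n k (s≤s z≤n)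
... | true  | there y∈′ rewrite +-suc k (length X) = map₁ <⇒≤ (select-ys-bounds φ (suc k) X y∈′)
... | false | y∈′       rewrite +-suc k (length X) = map₁ <⇒≤ (select-ys-bounds φ (suc k) X y∈′)

≡ᵇ-refl : ∀ n → (n ≡ᵇ n) ≡ true
≡ᵇ-refl n = T⇒≡ (≡⇒≡ᵇ n n refl)

<⇒≡ᵇ : ∀ {m n} → m < n → (m ≡ᵇ n) ≡ false
<⇒≡ᵇ {m} {n} m<n = ¬T⇒≡ (λ t → <⇒≢ m<n (≡ᵇ⇒≡ m n t))

∈ᵇ-here : ∀ v l → (v ∈ᵇ (v ∷ l)) ≡ true
∈ᵇ-here v l rewrite ≡ᵇ-refl v = refl

∈ᵇ-there : ∀ {u v} l → u < v → (v ∈ᵇ (u ∷ l)) ≡ (v ∈ᵇ l)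
∈ᵇ-there l u<v rewrite <⇒≡ᵇ u<v = refl

Gfrom-≥ : ∀ k X → All (λ p → k ≤ proj₂ p) (Gfrom k X)
Gfrom-≥ k []      = []
Gfrom-≥ k (x ∷ X) = ≤-refl ∷ All.map <⇒≤ (Gfrom-≥ (suc k) X)

-- The points of a graph have distinct times, so a time alone tells whether its point was selected.
∈ᵇ-select : ∀ φ k X → All (λ p → (proj₂ p ∈ᵇ ys (select φ (Gfrom k X))) ≡ φ p) (Gfrom k X)
∈ᵇ-select φ k []      = []
∈ᵇ-select φ k (x ∷ X) with φ (x , k) in eq
... | true  = trans (∈ᵇ-here k (ys (select φ (Gfrom (suc k) X)))) (sym eq) ∷
  All.zipWith (λ (k<y , e) → trans (∈ᵇ-there (ys (select φ (Gfrom (suc k) X))) k<y) e) (Gfrom-≥ (suc k) X , ∈ᵇ-select φ (suc k) X)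
... | false = trans (∉⇒∈ᵇ≡ _ (λ k∈ → <-irrefl refl (proj₁ (select-ys-bounds φ (suc k) X k∈)))) (sym eq) ∷
  ∈ᵇ-select φ (suc k) X

applyUpTo-cong : ∀ {g h : ℕ → ℕ} n → (∀ i → g i ≡ h i) → applyUpTo g n ≡ applyUpTo h n
applyUpTo-cong zero    e = refl
applyUpTo-cong (suc n) e = cong₂ _∷_ (e 0) (applyUpTo-cong n (e ∘ suc))

ys-Gfrom : ∀ k X → ys (Gfrom k X) ≡ applyUpTo (_+ k) (length X)
ys-Gfrom k []      = refl
ys-Gfrom k (x ∷ X) =
  cong (k ∷_) (trans (ys-Gfrom (suc k) X) (applyUpTo-cong (length X) (λ i → +-suc i k)))

-- Reading y-coordinates upwards is reading the accesses in order. Funnels and alternation are both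
-- mixes of this form, so both become words over the access sequence.
mix-select : ∀ φ ψ X →
  mix (ys (select φ (G X))) (ys (select ψ (G X))) ≡ mapMaybe (λ p → choose (φ p) (ψ p)) (G X)
mix-select φ ψ X = begin
    -- `mix` scans up to the largest selected time, the graph up to `N`. Both scans are prolonged by
    -- positions without a letter to a common length.
    mapMaybe g (upTo (suc M))            ≡⟨ mapMaybe-upTo-+ g (suc M) N beyondM ⟨
    mapMaybe g (upTo (N + suc M))        ≡⟨ cong (mapMaybe g ∘ upTo) (swap N M) ⟩
    mapMaybe g (upTo (M + suc N))        ≡⟨ mapMaybe-upTo-+ g (suc N) M beyondN ⟩
    mapMaybe g (upTo (suc N))            ≡⟨ mapMaybe-∷ g 0 (applyUpTo suc N) ⟩
    g 0 ∷? mapMaybe g (applyUpTo suc N)  ≡⟨ cong₂ _∷?_ g0 (cong (mapMaybe g) (sym times)) ⟩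
    mapMaybe g (ys (G X))                ≡⟨ mapMaybe-map g proj₂ (G X) ⟩
    mapMaybe (g ∘ proj₂) (G X)           ≡⟨ mapMaybe-cong-All (All.zipWith (λ (p , q) → cong₂ choose p q)
                                              (∈ᵇ-select φ 1 X , ∈ᵇ-select ψ 1 X)) ⟩
    mapMaybe (λ p → choose (φ p) (ψ p)) (G X) ∎
  where
  open ≡-Reasoning
  L = ys (select φ (G X))
  R = ys (select ψ (G X))
  M = maxList (L ++ R)
  N = length X
  g : ℕ → Maybe Bool
  g y = choose (y ∈ᵇ L) (y ∈ᵇ R)
  swap : ∀ a b → a + suc b ≡ b + suc a
  swap = solve-∀
  absent : ∀ y → ¬ y ∈ L → ¬ y ∈ R → g y ≡ nothing
  absent y y∉L y∉R rewrite ∉⇒∈ᵇ≡ L y∉L | ∉⇒∈ᵇ≡ R y∉R = refl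
  beyondM : ∀ y → suc M ≤ y → g y ≡ nothing
  beyondM y M<y = absent y (λ y∈ → <⇒≱ M<y (∈⇒≤maxList (Any.++⁺ˡ y∈)))
                           (λ y∈ → <⇒≱ M<y (∈⇒≤maxList (Any.++⁺ʳ L y∈)))
  beyondN : ∀ y → suc N ≤ y → g y ≡ nothing
  beyondN y N<y = absent y (λ y∈ → <⇒≱ (proj₂ (select-ys-bounds φ 1 X y∈)) N<y)
                           (λ y∈ → <⇒≱ (proj₂ (select-ys-bounds ψ 1 X y∈)) N<y)
  -- Times start at 1, the scan at 0.
  g0 : g 0 ≡ nothing
  g0 = absent 0 (λ y∈ → contradiction (proj₁ (select-ys-bounds φ 1 X y∈)) λ ())
                (λ y∈ → contradiction (proj₁ (select-ys-bounds ψ 1 X y∈)) λ ())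
  times : ys (G X) ≡ applyUpTo suc N
  times = trans (ys-Gfrom 1 X) (applyUpTo-cong N (λ i → +-comm i 1))

xs-Gfrom : ∀ k X → xs (Gfrom k X) ≡ X
xs-Gfrom k []      = refl
xs-Gfrom k (x ∷ X) = cong (x ∷_) (xs-Gfrom (suc k) X)

Gfrom-++ : ∀ k X Y → Gfrom k (X ++ Y) ≡ Gfrom k X ++ Gfrom (k + length X) Y
Gfrom-++ k []      Y = cong (λ j → Gfrom j Y) (sym (+-identityʳ k))
Gfrom-++ k (x ∷ X) Y = cong ((x , k) ∷_)
  (trans (Gfrom-++ (suc k) X Y) (cong (λ j → Gfrom (suc k) X ++ Gfrom j Y) (sym (+-suc k (length X)))))

-- Where the points of a graph lie relative to p, when the accesses zs occupy
-- the times from k up to just before p.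
Placed : ℕ → List ℕ → Point → Point → Set
Placed k zs p r = proj₂ r < k ⊎ r ∈ Gfrom k zs ⊎ r ≡ p ⊎ proj₂ p < proj₂ r

T-∧⁻ : ∀ {a b} → T (a ∧ b) → T a × T b
T-∧⁻ = Equivalence.to T-∧

T-∧⁺ : ∀ {a b} → T a → T b → T (a ∧ b)
T-∧⁺ a b = Equivalence.from T-∧ (a , b)

inRect⁻ : ∀ p q r → T (inRect p q r) →
  (proj₁ p ⊓ proj₁ q ≤ proj₁ r × proj₁ r ≤ proj₁ p ⊔ proj₁ q) ×
  (proj₂ p ⊓ proj₂ q ≤ proj₂ r × proj₂ r ≤ proj₂ p ⊔ proj₂ q)
inRect⁻ p q r t with T-∧⁻ t
... | a , t₁ with T-∧⁻ t₁
... | b , t₂ with T-∧⁻ t₂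
... | c , d = (≤ᵇ⇒≤ _ _ a , ≤ᵇ⇒≤ _ _ b) , (≤ᵇ⇒≤ _ _ c , ≤ᵇ⇒≤ _ _ d)

samePt-refl : ∀ p → samePt p p ≡ true
samePt-refl (a , b) rewrite ≡ᵇ-refl a | ≡ᵇ-refl b = refl

∈-Gfrom-x : ∀ {r} k X → r ∈ Gfrom k X → proj₁ r ∈ X
∈-Gfrom-x k (x ∷ X) (here refl) = here refl
∈-Gfrom-x k (x ∷ X) (there r∈)  = there (∈-Gfrom-x (suc k) X r∈)

-- Points before `q` or after `p` miss the rectangle by time and those strictly between by key; `p`
-- and `q` themselves are exempt.
emptyRect⁺ : ∀ {P x z k zs} → let p = (x , suc k + length zs) in
  All (Placed k (z ∷ zs) p) P → All (λ v → ¬ (x ⊓ z ≤ v × v ≤ x ⊔ z)) zs →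
  T (emptyRect P p (z , k))
emptyRect⁺ {P} {x} {z} {k} {zs} placed free = All.all⁻ _ (All.map ok placed)
  where
  t = suc k + length zs
  k<t : k < t
  k<t = s≤s (m≤m+n k (length zs))
  p q : Point
  p = (x , t)
  q = (z , k)
  apart : ∀ r → ¬ T (inRect p q r) → T (not (inRect p q r) ∨ samePt r p ∨ samePt r q)
  apart r ¬in rewrite ¬T⇒≡ ¬in = _
  ok : ∀ {r} → Placed k (z ∷ zs) p r → T (not (inRect p q r) ∨ samePt r p ∨ samePt r q)
  ok {r} (inj₁ y<k) = apart r (λ i → <⇒≱ y<k
    (≤-trans (⊓-glb (<⇒≤ k<t) ≤-refl) (proj₁ (proj₂ (inRect⁻ p q r i)))))
  ok {r} (inj₂ (inj₁ (here refl))) rewrite samePt-refl q with not (inRect p q q) | samePt q p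
  ... | true  | _     = _
  ... | false | true  = _
  ... | false | false = _
  ok {r} (inj₂ (inj₁ (there r∈))) = apart r (λ i → All.lookup free (∈-Gfrom-x (suc k) zs r∈) (proj₁ (inRect⁻ p q r i)))
  ok {r} (inj₂ (inj₂ (inj₁ refl))) rewrite samePt-refl p with not (inRect p q p)
  ... | true  = _
  ... | false = _
  ok {r} (inj₂ (inj₂ (inj₂ t<y))) = apart r (λ i → <⇒≱ t<y
    (≤-trans (proj₂ (proj₂ (inRect⁻ p q r i))) (⊔-lub ≤-refl (<⇒≤ k<t))))

-- The predicates filtered by `leftFunnel` and `rightFunnel`, named so that `mix-select` applies to
-- `funnelAt`.
leftOf rightOf : List Point → Point → Point → Bool
leftOf  P p q = (proj₂ q <ᵇ proj₂ p) ∧ (proj₁ q <ᵇ proj₁ p) ∧ emptyRect P p q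
rightOf P p q = (proj₂ q <ᵇ proj₂ p) ∧ (proj₁ p <ᵇ proj₁ q) ∧ emptyRect P p q

all-outside⁻ : ∀ a b zs → T (all (outside a b) zs) → All (λ v → ¬ (a ≤ v × v ≤ b)) zs
all-outside⁻ a b zs t = All.map excl (All.all⁺ (outside a b) zs t)
  where
  excl : ∀ {v} → T (outside a b v) → ¬ (a ≤ v × v ≤ b)
  excl o (a≤v , v≤b) = subst T (outside-self a≤v v≤b) o

leftOf⁺ : ∀ {P x z k zs} → let p = (x , suc k + length zs) in All (Placed k (z ∷ zs) p) P →
  T ((z <ᵇ x) ∧ all (outside z x) zs) → T (leftOf P p (z , k))
leftOf⁺ {x = x} {z} {k} {zs} placed t with T-∧⁻ {z <ᵇ x} t
... | z<ᵇx , free = T-∧⁺ (<⇒<ᵇ (s≤s (m≤m+n k (length zs)))) (T-∧⁺ z<ᵇx (emptyRect⁺ placed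
    (subst₂ (λ lo hi → All (λ v → ¬ (lo ≤ v × v ≤ hi)) zs)
      (sym (m≥n⇒m⊓n≡n z≤x)) (sym (m≥n⇒m⊔n≡m z≤x)) (all-outside⁻ z x zs free))))
  where z≤x = <⇒≤ (<ᵇ⇒< z x z<ᵇx)

rightOf⁺ : ∀ {P x z k zs} → let p = (x , suc k + length zs) in All (Placed k (z ∷ zs) p) P →
  T ((x <ᵇ z) ∧ all (outside x z) zs) → T (rightOf P p (z , k))
rightOf⁺ {x = x} {z} {k} {zs} placed t with T-∧⁻ {x <ᵇ z} t
... | x<ᵇz , free = T-∧⁺ (<⇒<ᵇ (s≤s (m≤m+n k (length zs)))) (T-∧⁺ x<ᵇz (emptyRect⁺ placed
    (subst₂ (λ lo hi → All (λ v → ¬ (lo ≤ v × v ≤ hi)) zs)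
      (sym (m≤n⇒m⊓n≡m x≤z)) (sym (m≤n⇒m⊔n≡n x≤z)) (all-outside⁻ x z zs free))))
  where x≤z = <⇒≤ (<ᵇ⇒< x z x<ᵇz)

¬leftOf : ∀ {P p q} → proj₁ p < proj₁ q → leftOf P p q ≡ false
¬leftOf {P} {p} {q} p<q = ¬T⇒≡ (λ t → <⇒≯ p<q
  (<ᵇ⇒< (proj₁ q) (proj₁ p) (proj₁ (T-∧⁻ (proj₂ (T-∧⁻ {proj₂ q <ᵇ proj₂ p} t))))))

letter-sound : ∀ {P x z k zs b} → let p = (x , suc k + length zs); q = (z , k) in
  All (Placed k (z ∷ zs) p) P → letter x z zs ≡ just b →
  choose (leftOf P p q) (rightOf P p q) ≡ just b
letter-sound {P} {x} {z} {k} {zs} placed eq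
  with (z <ᵇ x) ∧ all (outside z x) zs in l | (x <ᵇ z) ∧ all (outside x z) zs in r
... | true  | _    = trans
    (cong (λ a → choose a (rightOf P (x , suc k + length zs) (z , k))) (T⇒≡ (leftOf⁺ {P} placed (subst T (sym l) _)))) eq
... | false | true = trans (cong₂ choose
    (¬leftOf {P} {x , suc k + length zs} {z , k} (<ᵇ⇒< x z (proj₁ (T-∧⁻ (subst T (sym r) _)))))
    (T⇒≡ (rightOf⁺ {P} placed (subst T (sym r) _)))) eq
letter-sound placed () | false | false

-- Every letter produced by `letter` is the label of the same point in the actual mix. An inclusion
-- of words is what a lower bound on `funnelAt` uses.
funnelWord-⊆ : ∀ {P x} k zs → let p = (x , k + length zs) in All (Placed k zs p) P →
  funnelWord x zs ⊆ mapMaybe (λ q → choose (leftOf P p q) (rightOf P p q)) (Gfrom k zs)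
funnelWord-⊆         k []       placed = []
funnelWord-⊆ {P} {x} k (z ∷ zs) placed rewrite +-suc k (length zs) =
  subst (funnelWord x (z ∷ zs) ⊆_) (sym (mapMaybe-∷ g (z , k) (Gfrom (suc k) zs)))
    (prepend (letter x z zs) (letter-sound placed) (funnelWord-⊆ (suc k) zs (All.map advance placed)))
  where
  p = (x , suc k + length zs)
  g : Point → Maybe Bool
  g q = choose (leftOf P p q) (rightOf P p q)
  advance : ∀ {r} → Placed k (z ∷ zs) p r → Placed (suc k) zs p r
  advance (inj₁ y<k)                = inj₁ (m<n⇒m<1+n y<k)
  advance (inj₂ (inj₁ (here refl))) = inj₁ (n<1+n k)
  advance (inj₂ (inj₁ (there r∈)))  = inj₂ (inj₁ r∈)
  advance (inj₂ (inj₂ r))           = inj₂ (inj₂ r)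
  prepend : ∀ m {m′ : Maybe Bool} {u w} → (∀ {b} → m ≡ just b → m′ ≡ just b) → u ⊆ w → m ∷? u ⊆ m′ ∷? w
  prepend (just b) {m′} imp τ rewrite imp refl = refl ∷ τ
  prepend nothing  {m′} imp τ = ⊆-∷? m′ τ

funnelAt-≥ : ∀ pre x suf → let X = pre ++ x ∷ suf in
  blocks (funnelWord x pre) ≤ funnelAt (G X) (x , suc (length pre))
funnelAt-≥ pre x suf = begin
    blocks (funnelWord x pre)                             ≤⟨ blocks-⊆ (funnelWord-⊆ 1 pre placed) ⟩
    blocks (mapMaybe g (G pre))                           ≤⟨ blocks-⊆ (++⁺ʳ (mapMaybe g rest) ⊆-refl) ⟩
    blocks (mapMaybe g (G pre) ++ mapMaybe g rest)        ≡⟨ cong blocks (mapMaybe-++ g (G pre) rest) ⟨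
    blocks (mapMaybe g (G pre ++ rest))                   ≡⟨ cong (blocks ∘ mapMaybe g) (Gfrom-++ 1 pre (x ∷ suf)) ⟨
    blocks (mapMaybe g (G X))                             ≡⟨ cong blocks (mix-select (leftOf (G X) p) (rightOf (G X) p) X) ⟨
    funnelAt (G X) p                                      ∎
  where
  open ≤-Reasoning
  X = pre ++ x ∷ suf
  p = (x , suc (length pre))
  rest = Gfrom (suc (length pre)) (x ∷ suf)
  g : Point → Maybe Bool
  g q = choose (leftOf (G X) p q) (rightOf (G X) p q)
  placed : All (Placed 1 pre p) (G X)
  placed = subst (All (Placed 1 pre p)) (sym (Gfrom-++ 1 pre (x ∷ suf)))
    (All.++⁺ (All.tabulate (λ r∈ → inj₂ (inj₁ r∈)))
      (inj₂ (inj₂ (inj₁ refl)) ∷ All.map (λ t<y → inj₂ (inj₂ (inj₂ t<y))) (Gfrom-≥ _ suf)))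

funnelSum≤Funnel : ∀ X → funnelSum [] X ≤ Funnel (G X)
funnelSum≤Funnel X = go [] X
  where
  go : ∀ pre suf → funnelSum pre suf ≤
    sum (map (funnelAt (G (pre ++ suf))) (Gfrom (suc (length pre)) suf))
  go pre []        = z≤n
  go pre (x ∷ suf) = +-mono-≤ (funnelAt-≥ pre x suf)
    (subst₂ (λ Y j → funnelSum (pre ++ x ∷ []) suf ≤ sum (map (funnelAt (G Y)) (Gfrom (suc j) suf)))
      (++-assoc pre (x ∷ []) suf) (trans (length-++ pre) (+-comm (length pre) 1))
      (go (pre ++ x ∷ []) suf))

-- Alternation of access sequences

side : Tree → Tree → ℕ → Maybe Bool
side l r v = choose (v ∈ᵇ leaves l) (v ∈ᵇ leaves r)

-- The sequence is passed to the subtrees whole: `side` gives no letter to a key outside both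
-- subtrees, which replaces the restriction in `Alt`.
AltSeq : Tree → List ℕ → ℕ
AltSeq (leaf _)   X = 0
AltSeq (node l r) X = blocks (mapMaybe (side l r) X) + AltSeq l X + AltSeq r X

select-select : ∀ φ ψ P → (∀ p → T (φ p) → T (ψ p)) → select φ (select ψ P) ≡ select φ P
select-select φ ψ []      imp = refl
select-select φ ψ (p ∷ P) imp with ψ p in eqψ
... | true with φ p
...   | true  = cong (p ∷_) (select-select φ ψ P imp)
...   | false = select-select φ ψ P imp
select-select φ ψ (p ∷ P) imp | false with φ p in eqφ
...   | true  = ⊥-elim (subst T eqψ (imp p (subst T (sym eqφ) _)))
...   | false = select-select φ ψ P imp

∈ᵇ-++⁺ : ∀ {v} l l′ → T (v ∈ᵇ l) ⊎ T (v ∈ᵇ l′) → T (v ∈ᵇ (l ++ l′))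
∈ᵇ-++⁺ {v} l l′ (inj₁ t) = Any.any⁺ _ (Any.++⁺ˡ (Any.any⁻ (λ z → z ≡ᵇ v) l t))
∈ᵇ-++⁺ {v} l l′ (inj₂ t) = Any.any⁺ _ (Any.++⁺ʳ l (Any.any⁻ (λ z → z ≡ᵇ v) l′ t))

-- The selections made inside `t` use leaves of its subtrees, which are leaves of `t`, so they
-- absorb the outer selection.
Alt-restrict : ∀ t P → Alt t (restrict t P) ≡ Alt t P
Alt-restrict (leaf _)   P = refl
Alt-restrict (node l r) P = cong₂ (λ A B → mixValue (ys A) (ys B) + Alt l A + Alt r B)
  (select-select _ _ P (λ p t → ∈ᵇ-++⁺ (leaves l) (leaves r) (inj₁ t)))
  (select-select _ _ P (λ p t → ∈ᵇ-++⁺ (leaves l) (leaves r) (inj₂ t)))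

Alt≡AltSeq : ∀ t X → Alt t (G X) ≡ AltSeq t X
Alt≡AltSeq (leaf _)   X = refl
Alt≡AltSeq (node l r) X = cong₂ _+_ (cong₂ _+_ (cong blocks word)
    (trans (Alt-restrict l (G X)) (Alt≡AltSeq l X)))
    (trans (Alt-restrict r (G X)) (Alt≡AltSeq r X))
  where
  word : mix (ys (restrict l (G X))) (ys (restrict r (G X))) ≡ mapMaybe (side l r) X
  word = trans (mix-select _ _ X) (trans (sym (mapMaybe-map (side l r) proj₁ (G X)))
    (cong (mapMaybe (side l r)) (xs-Gfrom 1 X)))

AltSeq-++ : ∀ t X Y → AltSeq t (X ++ Y) ≤ AltSeq t X + AltSeq t Y
AltSeq-++ (leaf _)   X Y = z≤n
AltSeq-++ (node l r) X Y = begin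
    blocks (mapMaybe g (X ++ Y)) + AltSeq l (X ++ Y) + AltSeq r (X ++ Y)
      ≤⟨ +-mono-≤ (+-mono-≤ (≤-trans (≤-reflexive (cong blocks (mapMaybe-++ g X Y)))
           (blocks-++ (mapMaybe g X) (mapMaybe g Y))) (AltSeq-++ l X Y)) (AltSeq-++ r X Y) ⟩
    (a + a′) + (b + b′) + (c + c′)
      ≡⟨ e a a′ b b′ c c′ ⟩
    (a + b + c) + (a′ + b′ + c′) ∎
  where
  open ≤-Reasoning
  g = side l r
  a = blocks (mapMaybe g X)
  a′ = blocks (mapMaybe g Y)
  b = AltSeq l X
  b′ = AltSeq l Y
  c = AltSeq r X
  c′ = AltSeq r Y
  e : ∀ a a′ b b′ c c′ → (a + a′) + (b + b′) + (c + c′) ≡ (a + b + c) + (a′ + b′ + c′)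
  e = solve-∀

occ : Bool → List Bool → ℕ
occ b []      = 0
occ b (c ∷ w) = (if (b ∧ c) ∨ (not b ∧ not c) then 1 else 0) + occ b w

-- Each occurrence of `b` causes at most two changes, one on entering its run and one on leaving it.
-- Starting from `b` there is one more, on leaving the initial run; the two starts alternate in the
-- induction.
changes≤occ : ∀ b w → changes b w ≤ 1 + 2 * occ b w × changes (not b) w ≤ 2 * occ b w
changes≤occ b []      = z≤n , z≤n
changes≤occ b (c ∷ w) with changes≤occ b w
changes≤occ true  (true ∷ w)  | p , q = ≤-trans p (s≤s (*-monoʳ-≤ 2 (n≤1+n _))) , ≤-trans (s≤s p) (≤-reflexive (sym (*-suc 2 (occ true w))))
changes≤occ true  (false ∷ w) | p , q = s≤s q , q
changes≤occ false (true ∷ w)  | p , q = s≤s q , q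
changes≤occ false (false ∷ w) | p , q = ≤-trans p (s≤s (*-monoʳ-≤ 2 (n≤1+n _))) , ≤-trans (s≤s p) (≤-reflexive (sym (*-suc 2 (occ false w))))

-- With `b` free, the rarer letter can be chosen, which is how minima of counts enter the
-- alternation bound.
blocks≤occ : ∀ b w → blocks w ≤ 1 + 2 * occ b w
blocks≤occ b []              = z≤n
blocks≤occ true  (true ∷ w)  = m≤n⇒m≤1+n (proj₂ (changes≤occ true (true ∷ w)))
blocks≤occ true  (false ∷ w) = s≤s (proj₂ (changes≤occ true (false ∷ w)))
blocks≤occ false (true ∷ w)  = s≤s (proj₂ (changes≤occ false (true ∷ w)))
blocks≤occ false (false ∷ w) = m≤n⇒m≤1+n (proj₂ (changes≤occ false (false ∷ w)))

weight : (ℕ → ℕ) → List ℕ → ℕ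
weight f X = sum (map f X)

weight-++ : ∀ f X Y → weight f (X ++ Y) ≡ weight f X + weight f Y
weight-++ f X Y = trans (cong sum (map-++ f X Y)) (sum-++ (map f X) (map f Y))

weight-replicate : ∀ f K X → weight f (concat (replicate K X)) ≡ K * weight f X
weight-replicate f zero    X = refl
weight-replicate f (suc K) X = trans (weight-++ f X _) (cong (weight f X +_) (weight-replicate f K X))

weight-interleave : ∀ f g h I →
  weight f (interleave g h I) ≡ weight f (map (λ i → g (i + h)) I) + weight f (map g I)
weight-interleave f g h []      = refl
weight-interleave f g h (i ∷ I) rewrite weight-interleave f g h I =
  e (f (g i)) (f (g (i + h))) _ _
  where
  e : ∀ a b c d → a + (b + (c + d)) ≡ b + c + (a + d)
  e = solve-∀

-- Bit reversal permutes the indices below `2 ^ k`, so a sum over a round forgets the order; this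
-- ties letter counts to `cnt`.
weight-bitReversal : ∀ f k g → weight f (map g (bitReversal k)) ≡ Σ< (2 ^ k) (λ i → f (g i))
weight-bitReversal f zero    g = refl
weight-bitReversal f (suc k) g = begin
    weight f (map g (interleave id h (bitReversal k)))
      ≡⟨ cong (weight f) (map-interleave g h (bitReversal k)) ⟩
    weight f (interleave g h (bitReversal k))
      ≡⟨ weight-interleave f g h (bitReversal k) ⟩
    weight f (map (λ i → g (i + h)) (bitReversal k)) + weight f (map g (bitReversal k))
      ≡⟨ cong₂ _+_ (weight-bitReversal f k (λ i → g (i + h))) (weight-bitReversal f k g) ⟩
    Σ< h (λ i → f (g (i + h))) + Σ< h (λ i → f (g i))
      ≡⟨ Σ<-split h h (λ i → f (g i)) ⟨
    Σ< (h + h) (λ i → f (g i))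
      ≡⟨ cong (λ n → Σ< (h + n) (λ i → f (g i))) (+-identityʳ h) ⟨
    Σ< (2 ^ suc k) (λ i → f (g i)) ∎
  where
  open ≡-Reasoning
  h = 2 ^ k

occ≤weight : ∀ b (g : ℕ → Maybe Bool) f → (∀ v → g v ≡ just b → 1 ≤ f v) →
  ∀ X → occ b (mapMaybe g X) ≤ weight f X
occ≤weight b g f h []      = z≤n
occ≤weight b g f h (x ∷ X) with g x in eq | occ≤weight b g f h X
occ≤weight b     g f h (x ∷ X) | nothing    | ih = ≤-trans ih (m≤n+m _ (f x))
occ≤weight true  g f h (x ∷ X) | just true  | ih = +-mono-≤ (h x eq) ih
occ≤weight true  g f h (x ∷ X) | just false | ih = ≤-trans ih (m≤n+m _ (f x))
occ≤weight false g f h (x ∷ X) | just true  | ih = ≤-trans ih (m≤n+m _ (f x))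
occ≤weight false g f h (x ∷ X) | just false | ih = +-mono-≤ (h x eq) ih

Fits-∈ : ∀ {a t w v} → Fits a t w → v ∈ leaves t → a ≤ v × v < a + w
Fits-∈ (leaf a≤v v<) (here refl) = a≤v , v<
Fits-∈ {a} {v = v} (node {L = L} {l = l} {r} F G) v∈ with Any.++⁻ (leaves L) v∈
... | inj₁ v∈L = let (a≤v , v<) = Fits-∈ F v∈L in a≤v , <-≤-trans v< (+-monoʳ-≤ a (m≤m+n l r))
... | inj₂ v∈R = let (c≤v , v<) = Fits-∈ G v∈R in ≤-trans (m≤m+n a l) c≤v , subst (v <_) (+-assoc a l r) v<

choose-true : ∀ {a b} → choose a b ≡ just true → T a
choose-true {true} _ = _
choose-true {false} {true}  ()
choose-true {false} {false} ()

choose-false : ∀ {a b} → choose a b ≡ just false → T b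
choose-false {false} {true} _ = _

AllPairs-++⁻ : ∀ {A : Set} {R : A → A → Set} xs {ys} → AllPairs R (xs ++ ys) →
  AllPairs R xs × AllPairs R ys × All (λ x → All (R x) ys) xs
AllPairs-++⁻ []       ps       = [] , ps , []
AllPairs-++⁻ (x ∷ xs) (p ∷ ps) with AllPairs-++⁻ xs ps | All.++⁻ xs p
... | pxs , pys , pxy | px , py = px ∷ pxs , pys , py ∷ pxy

leaves-nonempty : ∀ t → ∃[ v ] ∃[ vs ] leaves t ≡ v ∷ vs
leaves-nonempty (leaf v)   = v , [] , refl
leaves-nonempty (node l r) with leaves-nonempty l
... | v , vs , eq = v , vs ++ leaves r , cong (_++ leaves r) eq

-- The cut is made at the first leaf `c` of the right subtree: by sortedness the leaves of `L` lie
-- below it and those of `R` at or above it.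
sorted⇒Fits : ∀ t a w → AllPairs _<_ (leaves t) → All (a ≤_) (leaves t) → All (_< a + w) (leaves t) → Fits a t w
sorted⇒Fits (leaf v)   a w _  (a≤v ∷ []) (v< ∷ []) = leaf a≤v v<
sorted⇒Fits (node L R) a w ps a≤ <b
  with AllPairs-++⁻ (leaves L) ps | All.++⁻ (leaves L) a≤ | All.++⁻ (leaves L) <b | leaves-nonempty R
... | psL , psR , L<R | a≤L , a≤R | _ , R<b | c , vs , eq = split
    (m≤n⇒∃[o]m+o≡n (All.lookup a≤R c∈R)) (m≤n⇒∃[o]m+o≡n (<⇒≤ (All.lookup R<b c∈R)))
  where
  c∈R : c ∈ leaves R
  c∈R = subst (c ∈_) (sym eq) (here refl)
  L<c : All (_< c) (leaves L)
  L<c = All.map (λ v<R → All.lookup v<R c∈R) L<R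
  head≤ : ∀ {vs} → AllPairs _<_ (c ∷ vs) → All (c ≤_) (c ∷ vs)
  head≤ (c< ∷ _) = ≤-refl ∷ All.map <⇒≤ c<
  c≤R : All (c ≤_) (leaves R)
  c≤R = subst (All (c ≤_)) (sym eq) (head≤ (subst (AllPairs _<_) eq psR))
  split : ∃[ l ] a + l ≡ c → ∃[ r ] c + r ≡ a + w → Fits a (node L R) w
  split (l , refl) (r , e) = subst (Fits a (node L R)) (+-cancelˡ-≡ a _ _ (trans (sym (+-assoc a l r)) e))
    (node (sorted⇒Fits L a l psL a≤L L<c)
          (sorted⇒Fits R c r psR c≤R (subst (λ b → All (_< b) (leaves R)) (sym e) R<b)))

-- The access sequence and its two estimates

module Sequence (k : ℕ) where

  -- `K` has two roles: it bounds all keys, since `s < n` and `2 ^ i ≤ n`, and it is the number of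
  -- rounds per shift. So many rounds make the number of tree nodes negligible against the `K * d`
  -- accesses of one shift.
  d n K : ℕ
  d = 2 ^ k
  n = 2 ^ d
  K = 2 * n

  open Counting d

  phase : ℕ → List ℕ
  phase s = map (λ i → s + 2 ^ i) (bitReversal k)

  rounds : ℕ → List ℕ
  rounds s = concat (replicate K (phase s))

  -- Shifts run downwards, in step with the recursion of `Σ<`.
  accesses : ℕ → List ℕ
  accesses m = concat (applyDownFrom rounds m)

  -- Counts the letter of whichever part holds fewer keys; each of the `K` rounds contains it at
  -- most as often as that part has keys.
  blocks-rounds : ∀ {a L R l r} s → Fits a L l → Fits (a + l) R r →
    blocks (mapMaybe (side L R) (rounds s)) ≤ 1 + 2 * (K * (cnt s a l ⊓ cnt s (a + l) r))
  blocks-rounds {a} {L} {R} {l} {r} s F G = bound (⊓-sel (cnt s a l) (cnt s (a + l) r))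
    where
    open ≤-Reasoning
    word = mapMaybe (side L R) (rounds s)
    via : ∀ b c w → (∀ v → side L R v ≡ just b → c ≤ v × v < c + w) →
      blocks word ≤ 1 + 2 * (K * cnt s c w)
    via b c w h = begin
      blocks word                ≤⟨ blocks≤occ b word ⟩
      1 + 2 * occ b word         ≤⟨ s≤s (*-monoʳ-≤ 2 (occ≤weight b (side L R) f
                                      (λ v eq → 1≤𝟙 (inRange? c w v) (h v eq)) (rounds s))) ⟩
      1 + 2 * weight f (rounds s) ≡⟨ cong (λ x → 1 + 2 * x) (trans (weight-replicate f K (phase s))
                                      (cong (K *_) (weight-bitReversal f k (λ i → s + 2 ^ i)))) ⟩
      1 + 2 * (K * cnt s c w)    ∎
      where
      f : ℕ → ℕ
      f v = 𝟙 (inRange? c w v)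
    bound : ∀ {m} → m ≡ cnt s a l ⊎ m ≡ cnt s (a + l) r → blocks word ≤ 1 + 2 * (K * m)
    bound (inj₁ refl) = via true a l (λ v eq → Fits-∈ F (∈ᵇ⇒∈ (leaves L) (choose-true eq)))
    bound (inj₂ refl) = via false (a + l) r (λ v eq → Fits-∈ G (∈ᵇ⇒∈ (leaves R) (choose-false {v ∈ᵇ leaves L} eq)))

  -- The additive 1 of `blocks-rounds` occurs once per internal node. There are fewer of these than
  -- leaves, and the leaves occupy disjoint intervals of width at least 1; the `suc` carries this
  -- count through the induction.
  AltSeq-rounds : ∀ {a t w} s (F : Fits a t w) → suc (AltSeq t (rounds s)) ≤ w + 2 * (K * minCost s F)
  AltSeq-rounds s (leaf a≤v v<) = ≤-trans (leaf-width a≤v v<) (m≤m+n _ _)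
  AltSeq-rounds s (node {a} {L} {R} {l} {r} F G) = begin
      suc (blocks (mapMaybe (side L R) (rounds s)) + x + y)
        ≤⟨ s≤s (+-monoˡ-≤ y (+-monoˡ-≤ x (blocks-rounds s F G))) ⟩
      suc (1 + 2 * (K * m) + x + y)
        ≡⟨ e K m x y ⟩
      2 * (K * m) + (suc x + suc y)
        ≤⟨ +-monoʳ-≤ (2 * (K * m)) (+-mono-≤ (AltSeq-rounds s F) (AltSeq-rounds s G)) ⟩
      2 * (K * m) + ((l + 2 * (K * minCost s F)) + (r + 2 * (K * minCost s G)))
        ≡⟨ e′ K m l (minCost s F) r (minCost s G) ⟩
      l + r + 2 * (K * (m + (minCost s F + minCost s G))) ∎
    where
    open ≤-Reasoning
    m = cnt s a l ⊓ cnt s (a + l) r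
    x = AltSeq L (rounds s)
    y = AltSeq R (rounds s)
    e : ∀ K m x y → suc (1 + 2 * (K * m) + x + y) ≡ 2 * (K * m) + (suc x + suc y)
    e = solve-∀
    e′ : ∀ K m l p r q → 2 * (K * m) + ((l + 2 * (K * p)) + (r + 2 * (K * q))) ≡ l + r + 2 * (K * (m + (p + q)))
    e′ = solve-∀

  AltSeq-accesses : ∀ t m → AltSeq t (accesses m) ≤ Σ< m (λ s → AltSeq t (rounds s))
  AltSeq-accesses t zero    = ≤-reflexive (AltSeq-[] t)
    where
    AltSeq-[] : ∀ t → AltSeq t [] ≡ 0
    AltSeq-[] (leaf _)   = refl
    AltSeq-[] (node l r) rewrite AltSeq-[] l | AltSeq-[] r = refl
  AltSeq-accesses t (suc m) = ≤-trans (AltSeq-++ t (rounds m) (accesses m))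
    (+-monoʳ-≤ (AltSeq t (rounds m)) (AltSeq-accesses t m))

  1≤d : 1 ≤ d
  1≤d = m^n>0 2 k

  AltSeq-bound : ∀ {a t} → Fits a t K → AltSeq t (accesses n) ≤ 19 * (n * (K * d))
  AltSeq-bound {t = t} F = begin
      AltSeq t (accesses n)
        ≤⟨ AltSeq-accesses t n ⟩
      Σ< n (λ s → AltSeq t (rounds s))
        ≤⟨ Σ<-mono n (λ s _ → ≤-trans (n≤1+n _) (AltSeq-rounds s F)) ⟩
      Σ< n (λ s → K + 2 * (K * minCost s F))
        ≡⟨ trans (Σ<-+ n _ _) (cong₂ _+_ (Σ<-const n K)
             (trans (Σ<-*ˡ n 2 _) (cong (2 *_) (Σ<-*ˡ n K _)))) ⟩
      n * K + 2 * (K * Σ< n (λ s → minCost s F))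
        ≤⟨ +-mono-≤ (≤-trans (≤-reflexive (sym (*-identityʳ (n * K)))) (*-monoʳ-≤ (n * K) 1≤d))
             (*-monoʳ-≤ 2 (*-monoʳ-≤ K (Σ-minCost≤ n F))) ⟩
      -- The constant is `1 + 2 * (8 + 1)`: 1 for the size of the tree, 8 for the potential at width
      -- `2 * n`, and 1 for the units.
      n * K * d + 2 * (K * (d * (4 * (2 * n)) + n * d))
        ≡⟨ e n K d ⟩
      19 * (n * (K * d)) ∎
    where
    open ≤-Reasoning
    e : ∀ n K d → n * K * d + 2 * (K * (d * (4 * (2 * n)) + n * d)) ≡ 19 * (n * (K * d))
    e = solve-∀

  length-accesses : ∀ m → length (accesses m) ≡ m * (K * d)
  length-accesses zero    = refl
  length-accesses (suc m) = trans (length-++ (rounds m)) (cong₂ _+_ (repeat K) (length-accesses m))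
    where
    repeat : ∀ j → length (concat (replicate j (phase m))) ≡ j * d
    repeat zero    = refl
    repeat (suc j) = trans (length-++ (phase m)) (cong₂ _+_
      (trans (length-map _ (bitReversal k)) (length-bitReversal k)) (repeat j))

  funnelSum-rounds : ∀ s j → j * (k * d) ≤ 2 * funnelSum [] (concat (replicate j (phase s)))
  funnelSum-rounds s zero    = z≤n
  funnelSum-rounds s (suc j) = begin
      k * d + j * (k * d)
        ≤⟨ +-mono-≤ (funnelSum-bitReversal k (λ i → s + 2 ^ i) (λ i<j → +-monoʳ-< s (^-monoʳ-< 2 (s≤s (s≤s z≤n)) i<j)))
             (funnelSum-rounds s j) ⟩
      2 * funnelSum [] (phase s) + 2 * funnelSum [] rest
        ≡⟨ *-distribˡ-+ 2 (funnelSum [] (phase s)) (funnelSum [] rest) ⟨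
      2 * (funnelSum [] (phase s) + funnelSum [] rest)
        ≤⟨ *-monoʳ-≤ 2 (funnelSum-superadditive (phase s) rest) ⟩
      2 * funnelSum [] (phase s ++ rest) ∎
    where
    open ≤-Reasoning
    rest = concat (replicate j (phase s))

  funnelSum-accesses : ∀ m → m * (K * (k * d)) ≤ 2 * funnelSum [] (accesses m)
  funnelSum-accesses zero    = z≤n
  funnelSum-accesses (suc m) = begin
      K * (k * d) + m * (K * (k * d))
        ≤⟨ +-mono-≤ (funnelSum-rounds m K) (funnelSum-accesses m) ⟩
      2 * funnelSum [] (rounds m) + 2 * funnelSum [] (accesses m)
        ≡⟨ *-distribˡ-+ 2 (funnelSum [] (rounds m)) (funnelSum [] (accesses m)) ⟨
      2 * (funnelSum [] (rounds m) + funnelSum [] (accesses m))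
        ≤⟨ *-monoʳ-≤ 2 (funnelSum-superadditive (rounds m) (accesses m)) ⟩
      2 * funnelSum [] (accesses (suc m)) ∎
    where open ≤-Reasoning

  accesses-range : ∀ m → m ≤ n → All (λ x → 1 ≤ x × x < K) (accesses m)
  accesses-range zero    _   = []
  accesses-range (suc m) m<n = All.++⁺ (repeat K) (accesses-range m (<⇒≤ m<n))
    where
    in-phase : All (λ x → 1 ≤ x × x < K) (phase m)
    in-phase = All.map⁺ (All.map (λ {i} i<d → ≤-trans (m^n>0 2 i) (m≤n+m (2 ^ i) m) ,
      subst (m + 2 ^ i <_) (cong (n +_) (sym (+-identityʳ n))) (+-mono-<-≤ m<n (^-monoʳ-≤ 2 (<⇒≤ i<d))))
      (bitReversal-< k))
    repeat : ∀ j → All (λ x → 1 ≤ x × x < K) (concat (replicate j (phase m)))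
    repeat zero    = []
    repeat (suc j) = All.++⁺ in-phase (repeat j)

-- Choice of parameters and the final constant

n≤2^n : ∀ n → n ≤ 2 ^ n
n≤2^n zero    = z≤n
n≤2^n (suc n) = +-mono-≤ (m^n>0 2 n) (≤-trans (n≤2^n n) (m≤m+n (2 ^ n) 0))

-- Write `k = suc j` and `d = 2 ^ k`. The inner logarithm is `d + 1`, at most `2 * d`, so the outer
-- one is at most `k + 1`, hence at most `2 * k` as `k` is positive.
loglog-bound : ∀ j → ⌊log₂ ⌊log₂ (2 * 2 ^ (2 ^ suc j)) ⌋ ⌋ ≤ 2 * suc j
loglog-bound j = begin
    ⌊log₂ ⌊log₂ (2 ^ suc (2 ^ suc j)) ⌋ ⌋   ≡⟨ cong ⌊log₂_⌋ (⌊log₂[2^n]⌋≡n (suc (2 ^ suc j))) ⟩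
    ⌊log₂ (suc (2 ^ suc j)) ⌋               ≤⟨ ⌊log₂⌋-mono-≤ (+-mono-≤ (m^n>0 2 (suc j)) (m≤m+n (2 ^ suc j) 0)) ⟩
    ⌊log₂ (2 ^ suc (suc j)) ⌋               ≡⟨ ⌊log₂[2^n]⌋≡n (suc (suc j)) ⟩
    suc (suc j)                             ≤⟨ s≤s (s≤s (m≤m+n j (j + 0))) ⟩
    suc (suc (j + (j + 0)))                 ≡⟨ cong suc (+-suc j (j + 0)) ⟨
    2 * suc j                               ∎
  where open ≤-Reasoning

-- The constant enters through its reciprocal, with logarithms rounded down. For `n ≥ 4` the
-- rounding loses less than half of the iterated logarithm, so `c = 1 / (2 q)` serves for the
-- real-valued one.
theorem2 : ∃[ q ] (1 ≤ q × (∀ N → ∃[ n ] (N ≤ n × ∃[ X ] (0 < length X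
    × All (λ x → 1 ≤ x × x ≤ n) X
    × (∀ (t : Tree) → IsReferenceTree t (G X)
    → ⌊log₂ ⌊log₂ n ⌋ ⌋ * (Alt t (G X) + length X) ≤ q * Funnel (G X))))))
-- 80 is the product of 2 from `loglog-bound`, `19 + 1` from alternation plus length, and 2 from the
-- halved funnel bound. The parameter `suc N` is positive, as `loglog-bound` requires.
theorem2 = 80 , s≤s z≤n , λ N → let open Sequence (suc N) in
    K , large N , accesses n , nonempty N , All.map (λ (p , q) → p , <⇒≤ q) (accesses-range n ≤-refl) , bound N
  where
  large : ∀ N → N ≤ Sequence.K (suc N)
  large N = ≤-trans (n≤1+n N) (≤-trans (n≤2^n (suc N)) (≤-trans (n≤2^n (2 ^ suc N)) (m≤m+n _ _)))
  nonempty : ∀ N → 0 < length (Sequence.accesses (suc N) (Sequence.n (suc N)))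
  nonempty N = subst (0 <_) (sym (length-accesses n))
      (*-mono-≤ (m^n>0 2 d) (*-mono-≤ (≤-trans (m^n>0 2 d) (m≤m+n n _)) 1≤d))
    where open Sequence (suc N)
  bound : ∀ N → let open Sequence (suc N); X = accesses n in ∀ t → IsReferenceTree t (G X) →
    ⌊log₂ ⌊log₂ K ⌋ ⌋ * (Alt t (G X) + length X) ≤ 80 * Funnel (G X)
  bound N t (sorted , labels) = begin
      ⌊log₂ ⌊log₂ K ⌋ ⌋ * (Alt t (G X) + length X)
        ≤⟨ *-mono-≤ (loglog-bound N) (+-mono-≤ (≤-trans (≤-reflexive (Alt≡AltSeq t X)) (AltSeq-bound fits))
             (≤-reflexive (length-accesses n))) ⟩
      2 * k * (19 * (n * (K * d)) + n * (K * d))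
        ≡⟨ e n K d k ⟩
      40 * (n * (K * (k * d)))
        ≤⟨ *-monoʳ-≤ 40 (funnelSum-accesses n) ⟩
      40 * (2 * funnelSum [] X)
        ≡⟨ *-assoc 40 2 (funnelSum [] X) ⟨
      80 * funnelSum [] X
        ≤⟨ *-monoʳ-≤ 80 (funnelSum≤Funnel X) ⟩
      80 * Funnel (G X) ∎
    where
    open ≤-Reasoning
    open Sequence (suc N)
    k = suc N
    X = accesses n
    <K : All (_< K) (leaves t)
    <K = All.tabulate (λ {v} v∈ → proj₂ (All.lookup (accesses-range n ≤-refl)
      (subst (v ∈_) (xs-Gfrom 1 X) (Equivalence.to (labels v) v∈))))
    fits : Fits 0 t K
    fits = sorted⇒Fits t 0 K (Linked⇒AllPairs <-trans sorted) (All.universal (λ _ → z≤n) (leaves t)) <K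
    e : ∀ n K d k → 2 * k * (19 * (n * (K * d)) + n * (K * d)) ≡ 40 * (n * (K * (k * d)))
    e = solve-∀
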